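{- There is an algorithm that, given a permutation graph $G$ with $n=|V(G)|$ and $m=|E(G)|$ together with a permutation representation of $G$, solves the Maximum Edge Open Packing problem on $G$ (that is, finds an edge open packing of $G$ of maximum cardinality $\rho_e^o(G)$) in $O(n^2+m^2)$ time.
   Context: All graphs are finite, simple and undirected. Two distinct edges $e_1,e_2\in E(G)$ have a common edge if there is an edge $e\in E(G)\setminus\{e_1,e_2\}$ joining an endpoint of $e_1$ to an endpoint of $e_2$. A set $D\subseteq E(G)$ is an edge open packing if no two edges of $D$ have a common edge. The edge open packing number $\rho_e^o(G)$ is the maximum cardinality of an edge open packing of $G$. The Maximum Edge Open Packing problem asks for an edge open packing of maximum cardinality. A graph $G$ is a permutation graph if there are two linear orders $<_1,<_2$ on $V(G)$ such that two vertices are adjacent precisely when they occur in opposite orders in $<_1$ and $<_2$; such a pair $(<_1,<_2)$ is a permutation representation of $G$. -}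

module Defs where

open import Data.Bool.Base using (if_then_else_)
open import Data.Fin.Base as Fin using (Fin; toℕ; fromℕ<; remQuot)
import Data.Fin.Properties as Fin
open import Data.List.Base using (List; length; filter; allFin; cartesianProduct; lookup)
open import Data.List.Membership.Propositional using (_∈_)
open import Data.List.Relation.Unary.All using (All)
open import Data.List.Relation.Unary.Unique.Propositional using (Unique)
open import Data.Nat.Base using (ℕ; suc; _+_; _∸_; _*_; _≤_; NonZero)
open import Data.Nat.Properties using (_<?_; _≟_)
open import Data.Product.Base using (_×_; _,_; ∃-syntax; proj₁; proj₂)
open import Data.Sum.Base using (_⊎_)
open import Function.Bundles using (_⇔_)
open import Level using (0ℓ)
open import Relation.Binary.Core using (Rel)
open import Relation.Binary.Definitions using (Decidable; Irreflexive; Symmetric)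
open import Relation.Binary.PropositionalEquality.Core using (_≡_; _≢_)
open import Relation.Binary.Structures using (IsStrictTotalOrder)
open import Relation.Nullary.Decidable.Core using (Dec; does; yes; no; _×-dec_)
open import Relation.Nullary.Negation.Core using (¬_)
import Relation.Unary as U

record Graph (n : ℕ) : Set₁ where
  field
    _~_      : Rel (Fin n) 0ℓ
    ~-sym    : Symmetric _~_
    ~-irrefl : Irreflexive _≡_ _~_
    _~?_     : Decidable _~_

module _ {n : ℕ} (G : Graph n) where
  open Graph G

  -- An undirected edge is stored once, smaller endpoint first, so that
  -- equality of edges is equality of pairs.
  IsEdge : Fin n × Fin n → Set
  IsEdge (u , v) = u Fin.< v × u ~ v

  isEdge? : U.Decidable IsEdge
  isEdge? (u , v) = (u Fin.<? v) ×-dec (u ~? v)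

  edges : List (Fin n × Fin n)
  edges = filter isEdge? (cartesianProduct (allFin n) (allFin n))

  ∣E∣ : ℕ
  ∣E∣ = length edges

  _endpointOf_ : Fin n → Fin n × Fin n → Set
  x endpointOf (u , v) = x ≡ u ⊎ x ≡ v

  _joins_and_ : Fin n × Fin n → Fin n → Fin n → Set
  e joins x and y = e ≡ (x , y) ⊎ e ≡ (y , x)

  HaveCommonEdge : Rel (Fin n × Fin n) 0ℓ
  HaveCommonEdge e₁ e₂ =
    ∃[ e ] IsEdge e × e ≢ e₁ × e ≢ e₂ ×
      (∃[ x ] ∃[ y ] x endpointOf e₁ × y endpointOf e₂ × e joins x and y)

  record IsEdgeOpenPacking (D : List (Fin n × Fin n)) : Set where
    field
      unique       : Unique D
      areEdges     : All IsEdge D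
      noCommonEdge : ∀ {e₁ e₂} → e₁ ∈ D → e₂ ∈ D → e₁ ≢ e₂ →
                     ¬ HaveCommonEdge e₁ e₂

  record IsMaximumEdgeOpenPacking (D : List (Fin n × Fin n)) : Set where
    field
      isEdgeOpenPacking : IsEdgeOpenPacking D
      maximum           : ∀ D′ → IsEdgeOpenPacking D′ → length D′ ≤ length D

  record PermutationRepresentation : Set₁ where
    field
      _<₁_ _<₂_ : Rel (Fin n) 0ℓ
      isSTO₁    : IsStrictTotalOrder _≡_ _<₁_
      isSTO₂    : IsStrictTotalOrder _≡_ _<₂_
      adjacent  : ∀ u v →
                  u ~ v ⇔ ((u <₁ v × v <₂ u) ⊎ (v <₁ u × u <₂ v))

-- Uniform-cost random access machine: structured programs over
-- natural-number registers and unbounded arrays (finitely many per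
-- program) with indirect addressing.  Addition
-- and truncated subtraction are the only arithmetic: with unit-cost
-- multiplication and unbounded words the model would be unrealistically
-- strong.

Reg Arr : Set
Reg = ℕ
Arr = ℕ

infixl 6 _⊕_ _⊖_

data Expr : Set where
  con     : ℕ → Expr
  reg     : Reg → Expr
  get     : Arr → Expr → Expr
  _⊕_ _⊖_ : Expr → Expr → Expr

infixr 4 _⨾_

data Program : Set where
  skip   : Program
  assign : Reg → Expr → Program
  put    : Arr → Expr → Expr → Program
  _⨾_    : Program → Program → Program
  ifnz   : Expr → Program → Program → Program
  while  : Expr → Program → Program

record State : Set where
  constructor state
  field
    regs : Reg → ℕ
    arrs : Arr → ℕ → ℕ

open State public

update : {A : Set} → (ℕ → A) → ℕ → A → ℕ → A
update f k a j = if does (j ≟ k) then a else f j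

setReg : State → Reg → ℕ → State
setReg σ x a = state (update (regs σ) x a) (arrs σ)

setArr : State → Arr → ℕ → ℕ → State
setArr σ r i a = state (regs σ) (update (arrs σ) r (update (arrs σ r) i a))

⟦_⟧ : Expr → State → ℕ
⟦ con a ⟧   σ = a
⟦ reg x ⟧   σ = regs σ x
⟦ get r e ⟧ σ = arrs σ r (⟦ e ⟧ σ)
⟦ e ⊕ f ⟧   σ = ⟦ e ⟧ σ + ⟦ f ⟧ σ
⟦ e ⊖ f ⟧   σ = ⟦ e ⟧ σ ∸ ⟦ f ⟧ σ

cost : Expr → ℕ
cost (con a)   = 1
cost (reg x)   = 1
cost (get r e) = suc (cost e)
cost (e ⊕ f)   = suc (cost e + cost f)
cost (e ⊖ f)   = suc (cost e + cost f)

-- ⟨ P , σ ⟩⇓[ t ] τ : started in σ, P halts in τ after exactly t steps.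
-- A test succeeds when its value is non-zero.
data ⟨_,_⟩⇓[_]_ : Program → State → ℕ → State → Set where
  skip⇓   : ∀ {σ} → ⟨ skip , σ ⟩⇓[ 1 ] σ
  assign⇓ : ∀ {σ x e} →
            ⟨ assign x e , σ ⟩⇓[ suc (cost e) ] setReg σ x (⟦ e ⟧ σ)
  put⇓    : ∀ {σ r e f} →
            ⟨ put r e f , σ ⟩⇓[ suc (cost e + cost f) ]
              setArr σ r (⟦ e ⟧ σ) (⟦ f ⟧ σ)
  seq⇓    : ∀ {σ τ υ P Q s t} →
            ⟨ P , σ ⟩⇓[ s ] τ → ⟨ Q , τ ⟩⇓[ t ] υ →
            ⟨ P ⨾ Q , σ ⟩⇓[ s + t ] υ
  ifnz⇓   : ∀ {σ τ e P Q t} → NonZero (⟦ e ⟧ σ) →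
            ⟨ P , σ ⟩⇓[ t ] τ →
            ⟨ ifnz e P Q , σ ⟩⇓[ suc (cost e + t) ] τ
  ifz⇓    : ∀ {σ τ e P Q t} → ⟦ e ⟧ σ ≡ 0 →
            ⟨ Q , σ ⟩⇓[ t ] τ →
            ⟨ ifnz e P Q , σ ⟩⇓[ suc (cost e + t) ] τ
  loop⇓   : ∀ {σ τ υ e P s t} → NonZero (⟦ e ⟧ σ) →
            ⟨ P , σ ⟩⇓[ s ] τ → ⟨ while e P , τ ⟩⇓[ t ] υ →
            ⟨ while e P , σ ⟩⇓[ suc (cost e + s + t) ] υ
  exit⇓   : ∀ {σ e P} → ⟦ e ⟧ σ ≡ 0 →
            ⟨ while e P , σ ⟩⇓[ suc (cost e) ] σ

cells : ∀ {k} → (Fin k → ℕ) → ℕ → ℕ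
cells {k} f i with i <? k
... | yes i<k = f (fromℕ< i<k)
... | no  _   = 0

-- Position of u in the order: the number of vertices below it.
rank : ∀ {n} {_<_ : Rel (Fin n) 0ℓ} → IsStrictTotalOrder _≡_ _<_ → Fin n → ℕ
rank {n} sto u = length (filter (λ v → v <ˢ? u) (allFin n))
  where open IsStrictTotalOrder sto renaming (_<?_ to _<ˢ?_)

-- Row-major: the entry for (u , v) is in cell toℕ u * n + toℕ v.
adjacencyMatrix : ∀ {n} → Graph n → Fin (n * n) → ℕ
adjacencyMatrix {n} G k with remQuot n k
... | u , v = if does (Graph._~?_ G u v) then 1 else 0

-- Register 0 holds n, array 0 the adjacency matrix, arrays 1 and 2 the
-- positions of the vertices in the two orders; the rest is zero.
input : ∀ {n} (G : Graph n) → PermutationRepresentation G → State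
input {n} G R = state inRegs inArrs
  where
  open PermutationRepresentation R

  inRegs : Reg → ℕ
  inRegs 0 = n
  inRegs _ = 0

  inArrs : Arr → ℕ → ℕ
  inArrs 0 = cells (adjacencyMatrix G)
  inArrs 1 = cells (rank isSTO₁)
  inArrs 2 = cells (rank isSTO₂)
  inArrs _ _ = 0

-- Register 0 holds the number of edges of D; arrays 0 and 1 list their
-- first and second endpoints.
record Outputs {n : ℕ} (σ : State) (D : List (Fin n × Fin n)) : Set where
  field
    size   : regs σ 0 ≡ length D
    first  : ∀ i → arrs σ 0 (toℕ i) ≡ toℕ (proj₁ (lookup D i))
    second : ∀ i → arrs σ 1 (toℕ i) ≡ toℕ (proj₂ (lookup D i))

SolvesWithin : Program → (ℕ → ℕ → ℕ) → Set₁
SolvesWithin P T =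
  ∀ {n} (G : Graph n) (R : PermutationRepresentation G) →
  ∃[ t ] ∃[ σ ] ∃[ D ]
    ⟨ P , input G R ⟩⇓[ t ] σ × t ≤ T n (∣E∣ G) ×
    Outputs σ D × IsMaximumEdgeOpenPacking G D

{-# OPTIONS --safe #-}
module Submission where

-- In an edge open packing the edges form an induced disjoint union of stars,
-- so every edge can be written as a dart (centre , leaf) whose leaf lies on no
-- other edge of the packing.  Non-adjacent vertices of a permutation graph are
-- ordered alike by both orders (u ≪ v), hence the leaves of a star form a
-- ≪-chain and the stars are ordered from left to right.  This makes the darts
-- of a packing a chain for a strict order _⟶_ on all 2m darts that is decided
-- in constant time, and conversely every ⟶-chain is a packing.  The
-- lexicographic order of the ranks of (centre , leaf) in the first order
-- extends _⟶_, so listing the darts in it costs n² steps, and computing longest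
-- chains by comparing all pairs of darts costs m² steps.

open import Data.Fin.Base as Fin using (Fin; toℕ; fromℕ<)
import Data.Fin.Properties as Fin
open import Data.List.Base using (List; []; _∷_; length; lookup; map; filter; allFin)
open import Data.List.Membership.Propositional using (_∈_; find; lose)
open import Data.List.Membership.Propositional.Properties
  using (∈-lookup; ∈-AllPairs₂; ∈-filter⁺; ∈-cartesianProduct⁺; ∈-allFin; ∈-map⁻)
import Data.List.Membership.Setoid.Properties as SetoidMembership
open import Data.List.Properties using (filter-notAll; length-map; length-tabulate)
open import Data.List.Relation.Unary.All as All using (All; []; _∷_)
import Data.List.Relation.Unary.All.Properties as All
open import Data.List.Relation.Unary.AllPairs using (AllPairs; []; _∷_)
import Data.List.Relation.Unary.AllPairs.Properties as AllPairs
open import Data.List.Relation.Unary.Any as Any using (here; there)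
open import Data.List.Relation.Unary.Unique.Propositional using (Unique)
open import Data.Nat.Base
  using (ℕ; zero; suc; _+_; _∸_; _*_; _^_; _⊓_; _⊔_; _≤_; _<_; z≤n; s≤s; NonZero)
open import Data.Nat.Induction using (<-rec)
open import Data.Nat.Properties as ℕ using (_<?_; _≟_)
open import Data.Nat.Solver using (module +-*-Solver)
open import Algebra.Properties.CommutativeSemigroup ℕ.*-commutativeSemigroup
  using (x∙yz≈y∙xz; x∙yz≈xz∙y)
open import Data.Product.Base using (_×_; _,_; ∃-syntax; proj₁; proj₂; swap)
open import Data.Product.Properties using (≡-dec)
open import Data.Sum.Base as Sum using (_⊎_; inj₁; inj₂)
open import Data.Sum.Properties using (inj₁-injective; inj₂-injective)
open import Function.Base using (_∘_; id)
open import Function.Bundles using (_⇔_; mk⇔; Equivalence)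
open import Function.Definitions using (Injective)
open import Level using (0ℓ)
open import Relation.Binary.Core using (Rel)
open import Relation.Binary.Definitions using (tri<; tri≈; tri>; DecidableEquality)
open import Relation.Binary.PropositionalEquality
open import Relation.Binary.Structures using (IsStrictTotalOrder)
open import Relation.Nullary using (¬_; Dec; yes; no; ¬?; contradiction; _×-dec_; _⊎-dec_)
open import Relation.Nullary.Decidable using (dec-true; dec-false)
import Relation.Unary as U
open import Defs

-- Edge open packings and chains of darts

-- If both endpoints of a packing edge lay on further packing edges, it would itself be a common
-- edge of two of those; this is why some endpoint can serve as a private leaf. The orientation is
-- chosen edge by edge and stars are never formed: pairwise comparability of the chosen darts is all
-- that optimality uses. Table values strictly increase along `⟶`, so comparable darts have
-- different values, and the pigeonhole principle bounds the packing by the number of values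
-- available. No packing has to be sorted into a chain. A sentinel after all darts turns the maximum
-- over all chains into a single table entry, which is also where the traceback starts. Time is
-- accounted for once for the whole program: every loop runs at most N = max(n, 2m + 1) times per
-- entry, the 1 being for the sentinel, and loops nest at most two deep, so the cost is O(N²), hence
-- O(n² + m² + 1).

lookup-injective : ∀ {A : Set} {xs : List A} → Unique xs → Injective _≡_ _≡_ (lookup xs)
lookup-injective {xs = _ ∷ _} (_   ∷ _)  {Fin.zero}  {Fin.zero}  _  = refl
lookup-injective {xs = _ ∷ _} (x∉ ∷ _)  {Fin.zero}  {Fin.suc j} eq =
  contradiction eq (All.lookup x∉ (∈-lookup j))
lookup-injective {xs = _ ∷ _} (x∉ ∷ _)  {Fin.suc i} {Fin.zero}  eq =
  contradiction (sym eq) (All.lookup x∉ (∈-lookup i))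
lookup-injective {xs = _ ∷ _} (_   ∷ u)  {Fin.suc i} {Fin.suc j} eq =
  cong Fin.suc (lookup-injective u eq)

join-injective : ∀ m n → Injective _≡_ _≡_ (Fin.join m n)
join-injective m n {s} {t} eq =
  trans (sym (Fin.splitAt-join m n s)) (trans (cong (Fin.splitAt m) eq) (Fin.splitAt-join m n t))

module Edges {n} (G : Graph n) where
  open Graph G

  private
    E = Fin n × Fin n

  _≟ᴱ_ : DecidableEquality E
  _≟ᴱ_ = ≡-dec Fin._≟_ Fin._≟_

  infix 4 _∈ᵉ_

  _∈ᵉ_ : Fin n → E → Set
  u ∈ᵉ e = (G Defs.endpointOf u) e

  endpoint? : ∀ u (e : E) → Dec (u ∈ᵉ e)
  endpoint? u (a , b) = (u Fin.≟ a) ⊎-dec (u Fin.≟ b)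

  edgeOf : E → E
  edgeOf (a , b) with a Fin.<? b
  ... | yes _ = a , b
  ... | no  _ = b , a

  edgeOf-joins : ∀ a b → (G Defs.joins edgeOf (a , b) and a) b
  edgeOf-joins a b with a Fin.<? b
  ... | yes _ = inj₁ refl
  ... | no  _ = inj₂ refl

  edgeOf-isEdge : ∀ {a b} → a ~ b → IsEdge G (edgeOf (a , b))
  edgeOf-isEdge {a} {b} a~b with a Fin.<? b
  ... | yes a<b = a<b , a~b
  ... | no  a≮b with Fin.<-cmp a b
  ...   | tri< a<b _ _ = contradiction a<b a≮b
  ...   | tri≈ _ a≡b _ = contradiction a~b (~-irrefl a≡b)
  ...   | tri> _ _ b<a = b<a , ~-sym a~b

  edgeOf-isEdge-id : ∀ {e} → IsEdge G e → edgeOf e ≡ e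
  edgeOf-isEdge-id {a , b} (a<b , _) with a Fin.<? b
  ... | yes _   = refl
  ... | no  a≮b = contradiction a<b a≮b

  edgeOf-swap : ∀ {e} → IsEdge G e → edgeOf (swap e) ≡ e
  edgeOf-swap {a , b} (a<b , _) with b Fin.<? a
  ... | yes b<a = contradiction a<b (ℕ.<-asym b<a)
  ... | no  _   = refl

  joins⇒≡ : ∀ {e a b} → IsEdge G e → (G Defs.joins e and a) b → e ≡ edgeOf (a , b)
  joins⇒≡ e∈E (inj₁ refl) = sym (edgeOf-isEdge-id e∈E)
  joins⇒≡ e∈E (inj₂ refl) = sym (edgeOf-swap e∈E)

  joins⇒~ : ∀ {e a b} → IsEdge G e → (G Defs.joins e and a) b → a ~ b
  joins⇒~ (_ , a~b) (inj₁ refl) = a~b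
  joins⇒~ (_ , b~a) (inj₂ refl) = ~-sym b~a

  edgeOf-injective : ∀ a b c d → edgeOf (a , b) ≡ edgeOf (c , d) →
                     (a ≡ c × b ≡ d) ⊎ (a ≡ d × b ≡ c)
  edgeOf-injective a b c d eq
    with edgeOf (a , b) | edgeOf-joins a b | edgeOf (c , d) | edgeOf-joins c d
  edgeOf-injective _ _ _ _ refl | _ | inj₁ refl | _ | inj₁ refl = inj₁ (refl , refl)
  edgeOf-injective _ _ _ _ refl | _ | inj₁ refl | _ | inj₂ refl = inj₂ (refl , refl)
  edgeOf-injective _ _ _ _ refl | _ | inj₂ refl | _ | inj₁ refl = inj₂ (refl , refl)
  edgeOf-injective _ _ _ _ refl | _ | inj₂ refl | _ | inj₂ refl = inj₁ (refl , refl)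

  endpointOf-edgeOf⁻ : ∀ {u a b} → u ∈ᵉ edgeOf (a , b) → u ≡ a ⊎ u ≡ b
  endpointOf-edgeOf⁻ {u} {a} {b} u∈ with edgeOf (a , b) | edgeOf-joins a b
  ... | _ | inj₁ refl = u∈
  ... | _ | inj₂ refl = Sum.swap u∈

  endpointOf-edgeOf⁺ : ∀ {u a b} → u ≡ a ⊎ u ≡ b → u ∈ᵉ edgeOf (a , b)
  endpointOf-edgeOf⁺ {u} {a} {b} u∈ with edgeOf (a , b) | edgeOf-joins a b
  ... | _ | inj₁ refl = u∈
  ... | _ | inj₂ refl = Sum.swap u∈

  endpoints⇒≡ : ∀ {u v e} → IsEdge G (u , v) → IsEdge G e → u ∈ᵉ e → v ∈ᵉ e → e ≡ (u , v)
  endpoints⇒≡ (_   , u~v) _         (inj₁ refl) (inj₁ refl) = contradiction u~v (~-irrefl refl)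
  endpoints⇒≡ _           _         (inj₁ refl) (inj₂ refl) = refl
  endpoints⇒≡ (u<v , _)   (v<u , _) (inj₂ refl) (inj₁ refl) = contradiction v<u (ℕ.<-asym u<v)
  endpoints⇒≡ (_   , u~v) _         (inj₂ refl) (inj₂ refl) = contradiction u~v (~-irrefl refl)

  haveCommonEdge-sym : ∀ {e e′} → HaveCommonEdge G e e′ → HaveCommonEdge G e′ e
  haveCommonEdge-sym (f , f∈E , f≢e , f≢e′ , a , b , a∈e , b∈e′ , j) =
    f , f∈E , f≢e′ , f≢e , b , a , b∈e′ , a∈e , Sum.swap j

  ∈-edges : ∀ {e} → IsEdge G e → e ∈ edges G
  ∈-edges e∈E = ∈-filter⁺ (isEdge? G) (∈-cartesianProduct⁺ (∈-allFin _) (∈-allFin _)) e∈E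

  orientedIndex : ∀ {d} → proj₁ d ~ proj₂ d → Fin (∣E∣ G) ⊎ Fin (∣E∣ G)
  orientedIndex {a , b} a~b with a Fin.<? b
  ... | yes _ = inj₁ (Any.index (∈-edges (edgeOf-isEdge a~b)))
  ... | no  _ = inj₂ (Any.index (∈-edges (edgeOf-isEdge a~b)))

  orientedIndex-injective : ∀ {d d′} (p : proj₁ d ~ proj₂ d) (p′ : proj₁ d′ ~ proj₂ d′) →
                            orientedIndex {d} p ≡ orientedIndex {d′} p′ → d ≡ d′
  orientedIndex-injective {a , b} {a′ , b′} p p′ eq with a Fin.<? b | a′ Fin.<? b′
  ... | yes a<b | yes a′<b′ = result
    where
    result : (a , b) ≡ (a′ , b′)
    result with edgeOf-injective a b a′ b′ (SetoidMembership.index-injective (setoid E) (∈-edges (edgeOf-isEdge p))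
                  (∈-edges (edgeOf-isEdge p′)) (inj₁-injective eq))
    ... | inj₁ (refl , refl) = refl
    ... | inj₂ (refl , refl) = contradiction a<b (ℕ.<-asym a′<b′)
  ... | no a≮b | no a′≮b′ = result
    where
    result : (a , b) ≡ (a′ , b′)
    result with edgeOf-injective a b a′ b′ (SetoidMembership.index-injective (setoid E) (∈-edges (edgeOf-isEdge p))
                  (∈-edges (edgeOf-isEdge p′)) (inj₂-injective eq))
    ... | inj₁ (refl , refl) = refl
    ... | inj₂ (refl , refl) with Fin.<-cmp a b
    ...   | tri< a<b _ _ = contradiction a<b a≮b
    ...   | tri≈ _ a≡b _ = contradiction p (~-irrefl a≡b)
    ...   | tri> _ _ b<a = contradiction b<a a′≮b′

  -- An edge carries two darts, told apart by which endpoint is the centre, so darts inject into two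
  -- copies of the edge list. This is where m enters the running time.
  darts≤2∣E∣ : ∀ {k} (d : Fin k → E) → Injective _≡_ _≡_ d →
               (∀ i → proj₁ (d i) ~ proj₂ (d i)) → k ≤ ∣E∣ G + ∣E∣ G
  darts≤2∣E∣ d d-inj d~ =
    Fin.injective⇒≤ {f = λ i → Fin.join _ _ (orientedIndex (d~ i))}
      λ {i} {j} eq → d-inj (orientedIndex-injective (d~ i) (d~ j) (join-injective _ _ eq))

module Diagram {n} (G : Graph n) (x y : Fin n → ℕ)
  (x-injective : Injective _≡_ _≡_ x) (y-injective : Injective _≡_ _≡_ y)
  (adjacent : ∀ u v → Graph._~_ G u v ⇔
                      ((x u < x v × y v < y u) ⊎ (x v < x u × y u < y v))) where
  open Graph G
  open Edges G

  Dart : Set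
  Dart = Fin n × Fin n

  IsDart : Dart → Set
  IsDart (c , l) = c ~ l

  infix 4 _≪_ _⟶_

  _≪_ : Fin n → Fin n → Set
  u ≪ v = x u < x v × y u < y v

  -- (c , l) stands for the edge cl of a star with centre c.  The edges of a
  -- star are ordered by their leaves, and different stars from left to right.
  _⟶_ : Dart → Dart → Set
  (c , l) ⟶ (c′ , l′) = l ≪ l′ × (c ≡ c′ ⊎ (c ≪ c′ × c ≪ l′ × l ≪ c′))

  ≪-trans : ∀ {u v w} → u ≪ v → v ≪ w → u ≪ w
  ≪-trans (p , q) (p′ , q′) = ℕ.<-trans p p′ , ℕ.<-trans q q′

  ≪⇒≁ : ∀ {u v} → u ≪ v → ¬ u ~ v
  ≪⇒≁ (p , q) u~v with Equivalence.to (adjacent _ _) u~v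
  ... | inj₁ (_ , q′) = ℕ.<-asym q q′
  ... | inj₂ (p′ , _) = ℕ.<-asym p p′

  ≁⇒≪ : ∀ {u v} → u ≢ v → ¬ u ~ v → u ≪ v ⊎ v ≪ u
  ≁⇒≪ {u} {v} u≢v u≁v with ℕ.<-cmp (x u) (x v) | ℕ.<-cmp (y u) (y v)
  ... | tri≈ _ xu≡xv _ | _ = contradiction (x-injective xu≡xv) u≢v
  ... | _ | tri≈ _ yu≡yv _ = contradiction (y-injective yu≡yv) u≢v
  ... | tri< p _ _ | tri< q _ _ = inj₁ (p , q)
  ... | tri> _ _ p | tri> _ _ q = inj₂ (p , q)
  ... | tri< p _ _ | tri> _ _ q = contradiction (Equivalence.from (adjacent u v) (inj₁ (p , q))) u≁v
  ... | tri> _ _ p | tri< q _ _ = contradiction (Equivalence.from (adjacent u v) (inj₂ (p , q))) u≁v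

  -- The direction of a comparison is carried along an edge: the opposite direction w ≪ u ≪ v would
  -- make the adjacent v and w comparable.
  ≪-stepʳ : ∀ {u v w} → v ~ w → u ≪ v → u ≪ w ⊎ w ≪ u → u ≪ w
  ≪-stepʳ v~w u≪v (inj₁ u≪w) = u≪w
  ≪-stepʳ v~w u≪v (inj₂ w≪u) = contradiction (~-sym v~w) (≪⇒≁ (≪-trans w≪u u≪v))

  ≪-stepˡ : ∀ {u v w} → u ~ w → u ≪ v → w ≪ v ⊎ v ≪ w → w ≪ v
  ≪-stepˡ u~w u≪v (inj₁ w≪v) = w≪v
  ≪-stepˡ u~w u≪v (inj₂ v≪w) = contradiction u~w (≪⇒≁ (≪-trans u≪v v≪w))

  -- A packing constrains every pair of edges, whereas predecessor links relate only neighbours in a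
  -- chain; transitivity closes this gap.
  ⟶-trans : ∀ {d d′ d″} → d ⟶ d′ → d′ ⟶ d″ → d ⟶ d″
  ⟶-trans (l , inj₁ refl) (l′ , inj₁ refl) = ≪-trans l l′ , inj₁ refl
  ⟶-trans (l , inj₁ refl) (l′ , inj₂ (p , q , r)) = ≪-trans l l′ , inj₂ (p , q , ≪-trans l r)
  ⟶-trans (l , inj₂ (p , q , r)) (l′ , inj₁ refl) = ≪-trans l l′ , inj₂ (p , ≪-trans q l′ , r)
  ⟶-trans (l , inj₂ (p , q , r)) (l′ , inj₂ (p′ , q′ , r′)) =
    ≪-trans l l′ , inj₂ (≪-trans p p′ , ≪-trans q l′ , ≪-trans r p′)

  -- Keeps a chain from using one edge in both orientations: l′ would then be c, and l ≪ c
  -- contradicts c ~ l.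
  ⟶⇒edgeOf≢ : ∀ {d d′} → IsDart d → d ⟶ d′ → edgeOf d ≢ edgeOf d′
  ⟶⇒edgeOf≢ {c , l} {c′ , l′} d~ (l≪l′ , _) eq with edgeOf-injective c l c′ l′ eq
  ... | inj₁ (_ , refl) = ℕ.<-irrefl refl (proj₁ l≪l′)
  ... | inj₂ (refl , _) = ≪⇒≁ l≪l′ (~-sym d~)

  ⟶⇒¬commonEdge : ∀ {d d′} → d ⟶ d′ → ¬ HaveCommonEdge G (edgeOf d) (edgeOf d′)
  ⟶⇒¬commonEdge {c , l} {c′ , l′} d⟶d′ (f , f∈E , f≢e , f≢e′ , a , b , a∈e , b∈e′ , j)
    with d⟶d′ | endpointOf-edgeOf⁻ {a} {c} {l} a∈e | endpointOf-edgeOf⁻ {b} {c′} {l′} b∈e′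
  ... | (l≪l′ , _)                | inj₂ refl | inj₂ refl = ≪⇒≁ l≪l′ (joins⇒~ f∈E j)
  ... | (_ , inj₁ refl)           | inj₁ refl | inj₁ refl = ~-irrefl refl (joins⇒~ f∈E j)
  -- Within one star, an edge from the centre to a leaf is one of the two given edges, which a
  -- common edge must avoid.
  ... | (_ , inj₁ refl)           | inj₁ refl | inj₂ refl = f≢e′ (joins⇒≡ f∈E j)
  ... | (_ , inj₁ refl)           | inj₂ refl | inj₁ refl = f≢e (joins⇒≡ f∈E (Sum.swap j))
  ... | (_ , inj₂ (c≪c′ , _ , _)) | inj₁ refl | inj₁ refl = ≪⇒≁ c≪c′ (joins⇒~ f∈E j)
  ... | (_ , inj₂ (_ , c≪l′ , _)) | inj₁ refl | inj₂ refl = ≪⇒≁ c≪l′ (joins⇒~ f∈E j)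
  ... | (_ , inj₂ (_ , _ , l≪c′)) | inj₂ refl | inj₁ refl = ≪⇒≁ l≪c′ (joins⇒~ f∈E j)

  chain⇒packing : ∀ {ds} → All IsDart ds → AllPairs _⟶_ ds → IsEdgeOpenPacking G (map edgeOf ds)
  chain⇒packing {ds} ds~ chain = record
    { unique       = AllPairs.map⁺ (distinct ds~ chain)
    ; areEdges     = All.map⁺ (All.map edgeOf-isEdge ds~)
    ; noCommonEdge = noCommonEdge
    }
    where
    distinct : ∀ {ds} → All IsDart ds → AllPairs _⟶_ ds → AllPairs (λ d d′ → edgeOf d ≢ edgeOf d′) ds
    distinct []        []       = []
    distinct (p ∷ ps) (r ∷ rs) = All.map (⟶⇒edgeOf≢ p) r ∷ distinct ps rs

    noCommonEdge : ∀ {e e′} → e ∈ map edgeOf ds → e′ ∈ map edgeOf ds → e ≢ e′ → ¬ HaveCommonEdge G e e′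
    noCommonEdge e∈ e′∈ e≢e′ with ∈-map⁻ edgeOf e∈ | ∈-map⁻ edgeOf e′∈
    ... | d , d∈ , refl | d′ , d′∈ , refl with ∈-AllPairs₂ chain d∈ d′∈
    ...   | inj₁ refl        = contradiction refl e≢e′
    ...   | inj₂ (inj₁ d⟶d′) = ⟶⇒¬commonEdge d⟶d′
    ...   | inj₂ (inj₂ d′⟶d) = ⟶⇒¬commonEdge d′⟶d ∘ haveCommonEdge-sym

  -- Only l ≪ l′ fixes a direction; for the other pairs comparability suffices, since the direction
  -- spreads from the leaves to the centres along the edges cl and c′l′.
  stars-ordered : ∀ {c l c′ l′} → c ~ l → c′ ~ l′ → l ≪ l′ →
                  l ≪ c′ ⊎ c′ ≪ l → c ≪ l′ ⊎ l′ ≪ c → c ≪ c′ ⊎ c′ ≪ c → (c , l) ⟶ (c′ , l′)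
  stars-ordered c~l c′~l′ l≪l′ lc′ cl′ cc′ =
    l≪l′ , inj₂ (≪-stepˡ (~-sym c~l) l≪c′ cc′ , ≪-stepˡ (~-sym c~l) l≪l′ cl′ , l≪c′)
    where l≪c′ = ≪-stepʳ (~-sym c′~l′) l≪l′ lc′

  module _ {D} (packing : IsEdgeOpenPacking G D) where
    open IsEdgeOpenPacking packing

    record Oriented (e : Fin n × Fin n) : Set where
      constructor oriented
      field
        centre leaf : Fin n
        edge≡       : edgeOf (centre , leaf) ≡ e
        isDart      : centre ~ leaf
        leafPrivate : ∀ {e′} → e′ ∈ D → e′ ≢ e → ¬ leaf ∈ᵉ e′

      dart : Dart
      dart = centre , leaf

    open Oriented

    orient : ∀ {e} → e ∈ D → Oriented e
    orient {u , v} e∈D with All.lookup areEdges e∈D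
    ... | e∈E@(_ , u~v) with Any.any? (λ e′ → ¬? (e′ ≟ᴱ (u , v)) ×-dec endpoint? v e′) D
    ...   | no  v-private = oriented u v (edgeOf-isEdge-id e∈E) u~v
              λ e′∈D e′≢e v∈e′ → v-private (lose e′∈D (e′≢e , v∈e′))
    ...   | yes v-shared with find v-shared
    ...     | e₁ , e₁∈D , e₁≢e , v∈e₁ = oriented v u (edgeOf-swap e∈E) (~-sym u~v) u-private
      where
      -- Otherwise uv is a common edge of e₁ and e₂.
      u-private : ∀ {e₂} → e₂ ∈ D → e₂ ≢ (u , v) → ¬ u ∈ᵉ e₂
      u-private {e₂} e₂∈D e₂≢e u∈e₂ = noCommonEdge e₁∈D e₂∈D e₁≢e₂
        ((u , v) , e∈E , e₁≢e ∘ sym , e₂≢e ∘ sym , v , u , v∈e₁ , u∈e₂ , inj₂ refl)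
        where
        e₁≢e₂ : e₁ ≢ e₂
        e₁≢e₂ refl = e₁≢e (endpoints⇒≡ e∈E (All.lookup areEdges e₁∈D) u∈e₂ v∈e₁)

    -- An edge ab would be a common edge: it differs from e because b is off e, and from e′ because
    -- a is off e′.
    disjoint⇒≁ : ∀ {e e′ a b} → e ∈ D → e′ ∈ D → e ≢ e′ →
                 a ∈ᵉ e → b ∈ᵉ e′ →
                 ¬ a ∈ᵉ e′ → ¬ b ∈ᵉ e → ¬ a ~ b
    disjoint⇒≁ {e} {e′} {a} {b} e∈D e′∈D e≢e′ a∈e b∈e′ a∉e′ b∉e a~b = noCommonEdge e∈D e′∈D e≢e′
      ( edgeOf (a , b) , edgeOf-isEdge a~b
      , (λ where refl → b∉e (endpointOf-edgeOf⁺ {b} {a} {b} (inj₂ refl)))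
      , (λ where refl → a∉e′ (endpointOf-edgeOf⁺ {a} {a} {b} (inj₁ refl)))
      , a , b , a∈e , b∈e′ , edgeOf-joins a b)

    oriented-comparable : ∀ {e e′} → e ∈ D → e′ ∈ D → e ≢ e′ →
                          (o : Oriented e) (o′ : Oriented e′) → dart o ⟶ dart o′ ⊎ dart o′ ⟶ dart o
    oriented-comparable e∈D e′∈D e≢e′ (oriented c l refl c~l l-private) (oriented c′ l′ refl c′~l′ l′-private) =
      compare (c Fin.≟ c′)
      where
      l∉e′ = l-private e′∈D (e≢e′ ∘ sym)
      l′∉e = l′-private e∈D e≢e′
      c∈e  = endpointOf-edgeOf⁺ {c} {c} {l} (inj₁ refl)
      l∈e  = endpointOf-edgeOf⁺ {l} {c} {l} (inj₂ refl)
      c′∈e′ = endpointOf-edgeOf⁺ {c′} {c′} {l′} (inj₁ refl)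
      l′∈e′ = endpointOf-edgeOf⁺ {l′} {c′} {l′} (inj₂ refl)

      comparable : ∀ {a b} → a ∈ᵉ edgeOf (c , l) → b ∈ᵉ edgeOf (c′ , l′) →
                   ¬ a ∈ᵉ edgeOf (c′ , l′) → ¬ b ∈ᵉ edgeOf (c , l) →
                   a ≪ b ⊎ b ≪ a
      comparable a∈e b∈e′ a∉e′ b∉e =
        ≁⇒≪ (λ where refl → b∉e a∈e) (disjoint⇒≁ e∈D e′∈D e≢e′ a∈e b∈e′ a∉e′ b∉e)

      compare : Dec (c ≡ c′) → (c , l) ⟶ (c′ , l′) ⊎ (c′ , l′) ⟶ (c , l)
      compare (yes refl) = Sum.map (_, inj₁ refl) (_, inj₁ refl) (comparable l∈e l′∈e′ l∉e′ l′∉e)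
      compare (no c≢c′)  = Sum.map
        (λ l≪l′ → stars-ordered c~l c′~l′ l≪l′ lc′ cl′ cc′)
        (λ l′≪l → stars-ordered c′~l′ c~l l′≪l (Sum.swap cl′) (Sum.swap lc′) (Sum.swap cc′))
        (comparable l∈e l′∈e′ l∉e′ l′∉e)
        where
        -- The centre c is not c′ by assumption, and it is not l′ because l′ is private and c lies
        -- on e.
        c∉e′ : ¬ c ∈ᵉ edgeOf (c′ , l′)
        c∉e′ c∈e′ with endpointOf-edgeOf⁻ {c} {c′} {l′} c∈e′
        ... | inj₁ c≡c′ = c≢c′ c≡c′
        ... | inj₂ refl = l′∉e c∈e

        c′∉e : ¬ c′ ∈ᵉ edgeOf (c , l)
        c′∉e c′∈e with endpointOf-edgeOf⁻ {c′} {c} {l} c′∈e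
        ... | inj₁ c′≡c = c≢c′ (sym c′≡c)
        ... | inj₂ refl = l∉e′ c′∈e′

        lc′ = comparable l∈e c′∈e′ l∉e′ c′∉e
        cl′ = comparable c∈e l′∈e′ c∉e′ l′∉e
        cc′ = comparable c∈e c′∈e′ c∉e′ c′∉e

    -- The darts of D are pairwise comparable, so f takes distinct values on them.
    packing≤ : ∀ {k} (f : ∀ {d} → IsDart d → Fin k) →
               (∀ {d d′} (p : IsDart d) (p′ : IsDart d′) → d ⟶ d′ → f p Fin.< f p′) → length D ≤ k
    packing≤ {k} f f-mono = Fin.injective⇒≤ g-injective
      where
      o : ∀ i → Oriented (lookup D i)
      o i = orient (∈-lookup i)

      g : Fin (length D) → Fin k
      g i = f (isDart (o i))

      g-injective : Injective _≡_ _≡_ g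
      g-injective {i} {j} gi≡gj with i Fin.≟ j
      ... | yes i≡j = i≡j
      ... | no  i≢j with oriented-comparable (∈-lookup i) (∈-lookup j) (i≢j ∘ lookup-injective unique) (o i) (o j)
      ...   | inj₁ lt = contradiction gi≡gj (Fin.<⇒≢ (f-mono (isDart (o i)) (isDart (o j)) lt))
      ...   | inj₂ lt = contradiction (sym gi≡gj) (Fin.<⇒≢ (f-mono (isDart (o j)) (isDart (o i)) lt))

-- Ranks

-- Punching out a missed value would leave an injection from n + 1 elements into n.
injective⇒surjective : ∀ {n} {f : Fin n → Fin n} → Injective _≡_ _≡_ f → ∀ i → ∃[ j ] f j ≡ i
injective⇒surjective {suc n} {f} f-injective i with Fin.any? (λ j → f j Fin.≟ i)
... | yes hit  = hit
... | no  miss = contradiction (Fin.injective⇒≤ {f = λ j → Fin.punchOut (i≢f j)} punch-injective) ℕ.1+n≰n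
  where
  i≢f : ∀ j → i ≢ f j
  i≢f j i≡fj = miss (j , sym i≡fj)

  punch-injective : Injective _≡_ _≡_ (λ j → Fin.punchOut (i≢f j))
  punch-injective {j} {j′} eq = f-injective (Fin.punchOut-injective (i≢f j) (i≢f j′) eq)

module _ {A : Set} {P Q : A → Set} (P? : U.Decidable P) (Q? : U.Decidable Q)
         (P⊆Q : ∀ {a} → P a → Q a) where

  length-filter-≤ : ∀ as → length (filter P? as) ≤ length (filter Q? as)
  length-filter-≤ [] = z≤n
  length-filter-≤ (a ∷ as) with P? a | Q? a
  ... | yes _ | yes _  = s≤s (length-filter-≤ as)
  ... | yes p | no  ¬q = contradiction (P⊆Q p) ¬q
  ... | no  _ | yes _  = ℕ.m≤n⇒m≤1+n (length-filter-≤ as)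
  ... | no  _ | no  _  = length-filter-≤ as

  length-filter-< : ∀ {a as} → a ∈ as → ¬ P a → Q a → length (filter P? as) < length (filter Q? as)
  length-filter-< {a} {_ ∷ as} (here refl) ¬p q with P? a | Q? a
  ... | yes p | _      = contradiction p ¬p
  ... | no  _ | yes _  = s≤s (length-filter-≤ as)
  ... | no  _ | no  ¬q = contradiction q ¬q
  length-filter-< {a} {b ∷ as} (there a∈as) ¬p q with P? b | Q? b
  ... | yes _ | yes _  = s≤s (length-filter-< a∈as ¬p q)
  ... | yes p | no  ¬q = contradiction (P⊆Q p) ¬q
  ... | no  _ | yes _  = ℕ.m≤n⇒m≤1+n (length-filter-< a∈as ¬p q)
  ... | no  _ | no  _  = length-filter-< a∈as ¬p q

module Rank {n} {_≺_ : Rel (Fin n) 0ℓ} (sto : IsStrictTotalOrder _≡_ _≺_) where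
  open IsStrictTotalOrder sto using (compare; irrefl) renaming (_<?_ to _≺?_; trans to ≺-trans)

  rank-mono : ∀ {u v} → u ≺ v → rank sto u < rank sto v
  rank-mono {u} {v} u≺v =
    length-filter-< (_≺? u) (_≺? v) (λ w≺u → ≺-trans w≺u u≺v) (∈-allFin u) (irrefl refl) u≺v

  rank-cancel : ∀ {u v} → rank sto u < rank sto v → u ≺ v
  rank-cancel {u} {v} lt with compare u v
  ... | tri< u≺v _ _ = u≺v
  ... | tri≈ _ refl _ = contradiction lt (ℕ.<-irrefl refl)
  ... | tri> _ _ v≺u = contradiction lt (ℕ.<-asym (rank-mono v≺u))

  rank-injective : Injective _≡_ _≡_ (rank sto)
  rank-injective {u} {v} eq with compare u v
  ... | tri< u≺v _ _ = contradiction eq (ℕ.<⇒≢ (rank-mono u≺v))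
  ... | tri≈ _ u≡v _ = u≡v
  ... | tri> _ _ v≺u = contradiction (sym eq) (ℕ.<⇒≢ (rank-mono v≺u))

  rank<n : ∀ u → rank sto u < n
  rank<n u = subst (rank sto u <_) (length-tabulate id)
    (filter-notAll (_≺? u) (allFin n) (Any.map (λ where refl → irrefl refl) (∈-allFin u)))

  rank-surjective : ∀ {p} → p < n → ∃[ u ] rank sto u ≡ p
  rank-surjective {p} p<n with injective⇒surjective {f = λ u → fromℕ< (rank<n u)}
      (λ {u} {v} eq → rank-injective (Fin.fromℕ<-injective _ _ (rank<n u) (rank<n v) eq)) (fromℕ< p<n)
  ... | u , eq = u , Fin.fromℕ<-injective _ _ (rank<n u) p<n eq

cells-toℕ : ∀ {k} (f : Fin k → ℕ) i → cells f (toℕ i) ≡ f i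
cells-toℕ {k} f i with toℕ i <? k
... | yes i<k = cong f (Fin.fromℕ<-toℕ i i<k)
... | no  i≮k = contradiction (Fin.toℕ<n i) i≮k

update-≡ : ∀ {A : Set} (f : ℕ → A) {k a j} → j ≡ k → update f k a j ≡ a
update-≡ _ {k = k} {j = j} j≡k rewrite dec-true (j ≟ k) j≡k = refl

update-≢ : ∀ {A : Set} (f : ℕ → A) {k a j} → j ≢ k → update f k a j ≡ f j
update-≢ _ {k = k} {j = j} j≢k rewrite dec-false (j ≟ k) j≢k = refl

-- Running times of programs

-- Bounds the running time of a program each of whose loops makes at most N
-- iterations every time it is entered.
steps : ℕ → Program → ℕ
steps N skip           = 1
steps N (assign x e)   = suc (cost e)
steps N (put r e f)    = suc (cost e + cost f)
steps N (P ⨾ Q)        = steps N P + steps N Q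
steps N (ifnz e P Q)   = suc (cost e + (steps N P + steps N Q))
steps N (while e P)    = N * (suc (cost e) + steps N P) + suc (cost e)

depth : Program → ℕ
depth skip         = 0
depth (assign x e) = 0
depth (put r e f)  = 0
depth (P ⨾ Q)      = depth P ⊔ depth Q
depth (ifnz e P Q) = depth P ⊔ depth Q
depth (while e P)  = suc (depth P)

module _ (N : ℕ) where

  private
    scale : ∀ {d} a → a ≤ a * suc N ^ d
    scale {d} a = ℕ.m≤m*n a (suc N ^ d) {{ℕ.m^n≢0 (suc N) d}}

  -- Each level of nesting contributes one factor N + 1, and the cost with a single iteration per
  -- loop serves as the coefficient, so an explicit constant is read off the program text.
  steps≤ : ∀ {d} P → depth P ≤ d → steps N P ≤ steps 1 P * suc N ^ d
  sum-bound : ∀ {d} P Q → depth P ⊔ depth Q ≤ d → steps N P + steps N Q ≤ (steps 1 P + steps 1 Q) * suc N ^ d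

  sum-bound {d} P Q h = ℕ.≤-trans
    (ℕ.+-mono-≤ (steps≤ P (ℕ.m⊔n≤o⇒m≤o _ _ h)) (steps≤ Q (ℕ.m⊔n≤o⇒n≤o _ _ h)))
    (ℕ.≤-reflexive (sym (ℕ.*-distribʳ-+ (suc N ^ d) (steps 1 P) (steps 1 Q))))

  steps≤ {d} skip         _ = scale {d} 1
  steps≤ {d} (assign x e) _ = scale {d} _
  steps≤ {d} (put r e f)  _ = scale {d} _
  steps≤ {d} (P ⨾ Q)      h = sum-bound P Q h
  steps≤ {d} (ifnz e P Q) h = ℕ.≤-trans (ℕ.+-mono-≤ (scale {d} (suc (cost e))) (sum-bound P Q h))
    (ℕ.≤-reflexive (sym (ℕ.*-distribʳ-+ (suc N ^ d) (suc (cost e)) (steps 1 P + steps 1 Q))))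
  steps≤ {suc d} (while e P) (s≤s h) = begin
    -- The final failing test is charged as one more full iteration, which gives the factor N + 1.
    N * (c + steps N P) + c               ≤⟨ ℕ.+-monoʳ-≤ (N * (c + steps N P)) (ℕ.m≤m+n c (steps N P)) ⟩
    N * (c + steps N P) + (c + steps N P) ≡⟨ ℕ.+-comm (N * (c + steps N P)) (c + steps N P) ⟩
    suc N * (c + steps N P)               ≤⟨ ℕ.*-monoʳ-≤ (suc N) (ℕ.+-mono-≤ (scale {d} c) (steps≤ P h)) ⟩
    suc N * (c * S + steps 1 P * S)       ≡⟨ cong (suc N *_) (sym (ℕ.*-distribʳ-+ S c (steps 1 P))) ⟩
    suc N * ((c + steps 1 P) * S)         ≡⟨ x∙yz≈y∙xz (suc N) (c + steps 1 P) S ⟩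
    (c + steps 1 P) * suc N ^ suc d       ≤⟨ ℕ.*-monoˡ-≤ (suc N ^ suc d) (ℕ.m≤m+n (c + steps 1 P) (0 + c)) ⟩
    (c + steps 1 P + (0 + c)) * suc N ^ suc d
      ≡⟨ cong (λ z → (z + c) * suc N ^ suc d) (sym (ℕ.+-identityʳ (c + steps 1 P))) ⟩
    steps 1 (while e P) * suc N ^ suc d   ∎
    where
    open ℕ.≤-Reasoning
    c = suc (cost e)
    S = suc N ^ d

-- A total-correctness triple. Measuring time against the syntactic `steps` makes the bound
-- independent of the state, so it composes along the program.
record Run (N : ℕ) (P : Program) (σ : State) (Q : State → Set) : Set where
  constructor run
  field
    {time}   : ℕ
    {result} : State
    executes : ⟨ P , σ ⟩⇓[ time ] result
    time≤    : time ≤ steps N P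
    post     : Q result

module _ {N : ℕ} {Q : State → Set} where

  run-map : ∀ {P σ} {R : State → Set} → (∀ {τ} → R τ → Q τ) → Run N P σ R → Run N P σ Q
  run-map f (run P⇓ t≤ r) = run P⇓ t≤ (f r)

  run-assign : ∀ {σ x e} → Q (setReg σ x (⟦ e ⟧ σ)) → Run N (assign x e) σ Q
  run-assign q = run assign⇓ ℕ.≤-refl q

  run-put : ∀ {σ r e f} → Q (setArr σ r (⟦ e ⟧ σ) (⟦ f ⟧ σ)) → Run N (put r e f) σ Q
  run-put q = run put⇓ ℕ.≤-refl q

  run-skip : ∀ {σ} → Q σ → Run N skip σ Q
  run-skip q = run skip⇓ ℕ.≤-refl q

  run-seq : ∀ {P P′ σ} {R : State → Set} → Run N P σ R → (∀ {τ} → R τ → Run N P′ τ Q) → Run N (P ⨾ P′) σ Q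
  run-seq (run P⇓ s≤ r) k with k r
  ... | run P′⇓ t≤ q = run (seq⇓ P⇓ P′⇓) (ℕ.+-mono-≤ s≤ t≤) q

  assign⨾ : ∀ {P σ x e} → Run N P (setReg σ x (⟦ e ⟧ σ)) Q → Run N (assign x e ⨾ P) σ Q
  assign⨾ (run P⇓ t≤ q) = run (seq⇓ assign⇓ P⇓) (ℕ.+-monoʳ-≤ _ t≤) q

  put⨾ : ∀ {P σ r e f} → Run N P (setArr σ r (⟦ e ⟧ σ) (⟦ f ⟧ σ)) Q → Run N (put r e f ⨾ P) σ Q
  put⨾ (run P⇓ t≤ q) = run (seq⇓ put⇓ P⇓) (ℕ.+-monoʳ-≤ _ t≤) q

  run-ifnz : ∀ {e P P′ σ} → (0 < ⟦ e ⟧ σ → Run N P σ Q) → (⟦ e ⟧ σ ≡ 0 → Run N P′ σ Q) →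
             Run N (ifnz e P P′) σ Q
  run-ifnz {e} {P} {P′} {σ} positive zero? with ⟦ e ⟧ σ in eq
  ... | zero  with zero? refl
  ...   | run P⇓ t≤ q = run (ifz⇓ eq P⇓) (s≤s (ℕ.+-monoʳ-≤ (cost e) (ℕ.m≤n⇒m≤o+n (steps N P) t≤))) q
  run-ifnz {e} {P} {P′} {σ} positive zero? | suc _ with positive (s≤s z≤n)
  ...   | run P⇓ t≤ q = run (ifnz⇓ (subst NonZero (sym eq) _) P⇓)
                            (s≤s (ℕ.+-monoʳ-≤ (cost e) (ℕ.m≤n⇒m≤n+o (steps N P′) t≤))) q

-- The invariant is indexed by the value of the test, which is the number of iterations left;
-- termination and the iteration count both follow.
run-while : ∀ {N e P} (I : ℕ → State → Set) → (∀ {r σ} → I r σ → ⟦ e ⟧ σ ≡ r) →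
            (∀ {r σ} → I (suc r) σ → Run N P σ (I r)) →
            ∀ {r σ} → r ≤ N → I r σ → Run N (while e P) σ (I 0)
run-while {N} {e} {P} I e≡ body {r} r≤N i =
  let (_ , _ , while⇓ , t≤ , q) = iterate r i in
  run while⇓ (ℕ.≤-trans t≤ (ℕ.+-monoˡ-≤ (suc (cost e)) (ℕ.*-monoˡ-≤ (suc (cost e) + steps N P) r≤N))) q
  where
  iterate : ∀ r {σ} → I r σ → ∃[ t ] ∃[ τ ] ⟨ while e P , σ ⟩⇓[ t ] τ ×
            t ≤ r * (suc (cost e) + steps N P) + suc (cost e) × I 0 τ
  iterate zero i = _ , _ , exit⇓ (e≡ i) , ℕ.≤-refl , i
  iterate (suc r) i with body i
  ... | run P⇓ s≤ i′ with iterate r i′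
  ...   | _ , _ , while⇓ , t≤ , q = _ , _ , loop⇓ (subst NonZero (sym (e≡ i)) _) P⇓ while⇓
        , ℕ.≤-trans (ℕ.+-mono-≤ (s≤s (ℕ.+-monoʳ-≤ (cost e) s≤)) t≤)
            (ℕ.≤-reflexive (sym (ℕ.+-assoc (suc (cost e) + steps N P) (r * (suc (cost e) + steps N P)) (suc (cost e)))))
        , q

run-upto : ∀ {M e P N} (J : ℕ → State → Set) → (∀ {i σ} → J i σ → ⟦ e ⟧ σ ≡ N ∸ i) →
           (∀ {i σ} → i < N → J i σ → Run M P σ (J (suc i))) →
           ∀ {σ} → N ≤ M → J 0 σ → Run M (while e P) σ (J N)
run-upto {M} {e} {P} {N} J e≡ body N≤M j₀ =
  run-map (λ {τ} (i , eq , j) → subst (λ i → J i τ) (trans (sym (ℕ.+-identityʳ i)) eq) j)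
    (run-while (λ r σ → ∃[ i ] i + r ≡ N × J i σ) e≡r body′ N≤M (0 , refl , j₀))
  where
  e≡r : ∀ {r σ} → ∃[ i ] i + r ≡ N × J i σ → ⟦ e ⟧ σ ≡ r
  e≡r {r} (i , refl , j) = trans (e≡ j) (ℕ.m+n∸m≡n i r)

  body′ : ∀ {r σ} → ∃[ i ] i + suc r ≡ N × J i σ → Run M P σ (λ τ → ∃[ i ] i + r ≡ N × J i τ)
  body′ {r} (i , eq , j) with body (ℕ.≤-trans (ℕ.m<m+n i (s≤s z≤n)) (ℕ.≤-reflexive eq)) j
  ... | run P⇓ t≤ j′ = run P⇓ t≤ (suc i , trans (sym (ℕ.+-suc i r)) eq , j′)

-- The algorithm

infixr 7 _∧_

-- The minimum, written with truncated subtraction because the machine has no comparison. It serves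
-- as conjunction of truth values and, in the output, selects the smaller endpoint.
_∧_ : ℕ → ℕ → ℕ
a ∧ b = a ∸ (a ∸ b)

∧≡⊓ : ∀ a b → a ∧ b ≡ a ⊓ b
∧≡⊓ a b with ℕ.≤-total a b
... | inj₁ a≤b rewrite ℕ.m≤n⇒m∸n≡0 a≤b = sym (ℕ.m≤n⇒m⊓n≡m a≤b)
... | inj₂ b≤a = trans (ℕ.m∸[m∸n]≡n b≤a) (sym (ℕ.m≥n⇒m⊓n≡n b≤a))

∧-positive : ∀ {a b} → 0 < a ∧ b ⇔ (0 < a × 0 < b)
∧-positive {a} {b} rewrite ∧≡⊓ a b = mk⇔
  (λ p → ℕ.m<n⊓o⇒m<n a b p , ℕ.m<n⊓o⇒m<o a b p) (λ (p , q) → ℕ.⊓-glb p q)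

∸-positive : ∀ {a b} → 0 < b ∸ a ⇔ a < b
∸-positive {a} {b} = mk⇔ (λ p → ℕ.m∸n≢0⇒n<m (ℕ.>⇒≢ p)) ℕ.m<n⇒0<n∸m

+-positive : ∀ {a b} → 0 < a + b ⇔ (0 < a ⊎ 0 < b)
+-positive {zero}  {b} = mk⇔ inj₂ λ where (inj₁ ()) ; (inj₂ p) → p
+-positive {suc a} {b} = mk⇔ (λ _ → inj₁ (s≤s z≤n)) (λ _ → s≤s z≤n)

equal : ℕ → ℕ → ℕ
equal a b = 1 ∸ ((a ∸ b) + (b ∸ a))

equal-positive : ∀ {a b} → 0 < equal a b ⇔ a ≡ b
equal-positive {a} {b} = mk⇔ to λ where refl → from {a}
  where
  to : 0 < equal a b → a ≡ b
  to p = ℕ.≤-antisym (ℕ.m∸n≡0⇒m≤n (ℕ.m+n≡0⇒m≡0 (a ∸ b) none))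
                     (ℕ.m∸n≡0⇒m≤n (ℕ.m+n≡0⇒n≡0 (a ∸ b) none))
    where none = ℕ.n<1⇒n≡0 (Equivalence.to ∸-positive p)

  from : ∀ {a} → 0 < equal a a
  from {a} rewrite ℕ.n∸n≡0 a = s≤s z≤n

-- A vertex is handled through its position in the first order; π sends it to
-- the position in the second order.  A truth value is true when positive.
crossing precedes : (ℕ → ℕ) → ℕ → ℕ → ℕ
crossing π p q = (q ∸ p) ∧ (π p ∸ π q) + (p ∸ q) ∧ (π q ∸ π p)
precedes π p q = (q ∸ p) ∧ (π q ∸ π p)

step : (ℕ → ℕ) → ℕ × ℕ → ℕ × ℕ → ℕ
step π (p , q) (p′ , q′) =
  precedes π q q′ ∧ (equal p p′ + precedes π p p′ ∧ precedes π p q′ ∧ precedes π q p′)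

Precedes : (ℕ → ℕ) → ℕ → ℕ → Set
Precedes π p q = p < q × π p < π q

precedes-positive : ∀ {π p q} → 0 < precedes π p q ⇔ Precedes π p q
precedes-positive {π} {p} {q} = mk⇔
  (λ h → let (a , b) = Equivalence.to ∧-positive h in
         Equivalence.to ∸-positive a , Equivalence.to ∸-positive b)
  (λ (a , b) → Equivalence.from ∧-positive
         (Equivalence.from ∸-positive a , Equivalence.from ∸-positive b))

crossing-positive : ∀ {π p q} → 0 < crossing π p q ⇔ ((p < q × π q < π p) ⊎ (q < p × π p < π q))
crossing-positive {π} {p} {q} = mk⇔
  (λ h → Sum.map to to (Equivalence.to +-positive h))
  (λ h → Equivalence.from (+-positive {(q ∸ p) ∧ (π p ∸ π q)}) (Sum.map from from h))
  where
  to : ∀ {a b c d} → 0 < (a ∸ b) ∧ (c ∸ d) → b < a × d < c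
  to h = let (a , b) = Equivalence.to ∧-positive h in
         Equivalence.to ∸-positive a , Equivalence.to ∸-positive b

  from : ∀ {a b c d} → b < a × d < c → 0 < (a ∸ b) ∧ (c ∸ d)
  from (a , b) = Equivalence.from ∧-positive
                   (Equivalence.from ∸-positive a , Equivalence.from ∸-positive b)

Step : (ℕ → ℕ) → ℕ × ℕ → ℕ × ℕ → Set
Step π (p , q) (p′ , q′) =
  Precedes π q q′ × (p ≡ p′ ⊎ (Precedes π p p′ × Precedes π p q′ × Precedes π q p′))

step-positive : ∀ π d d′ → 0 < step π d d′ ⇔ Step π d d′
step-positive π (p , q) (p′ , q′) = mk⇔ to from
  where
  to : 0 < step π (p , q) (p′ , q′) → Step π (p , q) (p′ , q′)
  to h with Equivalence.to (∧-positive {precedes π q q′}) h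
  ... | qq′ , h′ with Equivalence.to (+-positive {equal p p′}) h′
  ...   | inj₁ e = Equivalence.to precedes-positive qq′ , inj₁ (Equivalence.to equal-positive e)
  ...   | inj₂ r with Equivalence.to (∧-positive {precedes π p p′}) r
  ...     | pp′ , r′ with Equivalence.to (∧-positive {precedes π p q′}) r′
  ...       | pq′ , qp′ = Equivalence.to precedes-positive qq′ ,
    inj₂ (Equivalence.to precedes-positive pp′ , Equivalence.to precedes-positive pq′
         , Equivalence.to precedes-positive qp′)

  from : Step π (p , q) (p′ , q′) → 0 < step π (p , q) (p′ , q′)
  from (qq′ , h) = Equivalence.from (∧-positive {precedes π q q′})
    (Equivalence.from precedes-positive qq′ , Equivalence.from (+-positive {equal p p′}) (Sum.map
      (Equivalence.from equal-positive)
      (λ (a , b , c) → Equivalence.from (∧-positive {precedes π p p′})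
        (Equivalence.from precedes-positive a , Equivalence.from (∧-positive {precedes π p q′})
          (Equivalence.from precedes-positive b , Equivalence.from precedes-positive c)))
      h))

infixr 7 _∧ᴱ_

_∧ᴱ_ : Expr → Expr → Expr
e ∧ᴱ f = e ⊖ (e ⊖ f)

-- These copy the numeric functions symbol by symbol, with array 4 as π, so that their values are
-- the numeric ones by computation and tests need no evaluation lemmas.
precedesᴱ crossingᴱ equalᴱ : Expr → Expr → Expr
precedesᴱ e f = (f ⊖ e) ∧ᴱ (get 4 f ⊖ get 4 e)
crossingᴱ e f = ((f ⊖ e) ∧ᴱ (get 4 e ⊖ get 4 f)) ⊕ ((e ⊖ f) ∧ᴱ (get 4 f ⊖ get 4 e))
equalᴱ    e f = con 1 ⊖ ((e ⊖ f) ⊕ (f ⊖ e))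

stepᴱ : (c l c′ l′ : Expr) → Expr
stepᴱ c l c′ l′ =
  precedesᴱ l l′ ∧ᴱ (equalᴱ c c′ ⊕ (precedesᴱ c c′ ∧ᴱ precedesᴱ c l′ ∧ᴱ precedesᴱ l c′))

-- Register 0: n; 1, 2: positions p, q; 3: number k of darts; 4, 5: indices of
-- darts; 6, 7: best value and its predecessor.  Array 3: vertex at a position;
-- 4: π; 5, 6: centres and leaves of the darts, as positions; 7: length of a
-- longest chain strictly before a dart; 8: predecessor in such a chain.  In
-- trace, register 1 counts the edges still to be written, last edge first.
invertBody : Program
invertBody = put 3 (get 1 (reg 1)) (reg 1) ⨾ put 4 (get 1 (reg 1)) (get 2 (reg 1)) ⨾
             assign 1 (con 1 ⊕ reg 1)

invert : Program
-- The last write extends π by n ↦ n, which puts position n after every vertex in both orders.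
invert = while (reg 0 ⊖ reg 1) invertBody ⨾ put 4 (reg 0) (reg 0)

rowBody : Program
rowBody = ifnz (crossingᴱ (reg 1) (reg 2))
               (put 5 (reg 3) (reg 1) ⨾ put 6 (reg 3) (reg 2) ⨾ assign 3 (con 1 ⊕ reg 3)) skip ⨾
          assign 2 (con 1 ⊕ reg 2)

collectBody : Program
collectBody = assign 2 (con 0) ⨾ while (reg 0 ⊖ reg 2) rowBody ⨾ assign 1 (con 1 ⊕ reg 1)

-- The sentinel (n , n) comes after every dart.
collect : Program
collect = assign 1 (con 0) ⨾ assign 3 (con 0) ⨾ while (reg 0 ⊖ reg 1) collectBody ⨾
          put 5 (reg 3) (reg 0) ⨾ put 6 (reg 3) (reg 0)

relaxBody : Program
relaxBody =
  ifnz ((con 1 ⊕ get 7 (reg 5) ⊖ reg 6) ∧ᴱ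
        stepᴱ (get 5 (reg 5)) (get 6 (reg 5)) (get 5 (reg 4)) (get 6 (reg 4)))
       (assign 6 (con 1 ⊕ get 7 (reg 5)) ⨾ assign 7 (reg 5)) skip ⨾
  assign 5 (con 1 ⊕ reg 5)

chainBody : Program
chainBody = assign 6 (con 0) ⨾ assign 5 (con 0) ⨾ while (reg 4 ⊖ reg 5) relaxBody ⨾
            put 7 (reg 4) (reg 6) ⨾ put 8 (reg 4) (reg 7) ⨾ assign 4 (con 1 ⊕ reg 4)

chains : Program
-- The bound is k + 1, not k: the sentinel gets a table entry too.
chains = assign 4 (con 0) ⨾ while (con 1 ⊕ reg 3 ⊖ reg 4) chainBody

minᴱ maxᴱ : Expr → Expr → Expr
minᴱ = _∧ᴱ_
maxᴱ e f = e ⊕ (f ⊖ e)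

traceBody : Program
traceBody =
  assign 4 (get 8 (reg 4)) ⨾ assign 1 (reg 1 ⊖ con 1) ⨾
  put 0 (reg 1) (minᴱ (get 3 (get 5 (reg 4))) (get 3 (get 6 (reg 4)))) ⨾
  put 1 (reg 1) (maxᴱ (get 3 (get 5 (reg 4))) (get 3 (get 6 (reg 4))))

trace : Program
trace = assign 0 (get 7 (reg 3)) ⨾ assign 1 (get 7 (reg 3)) ⨾ assign 4 (reg 3) ⨾
        while (reg 1) traceBody

solve : Program
solve = invert ⨾ collect ⨾ chains ⨾ trace

-- Listing the darts in lexicographic order

infix 4 _<ₗ_

_<ₗ_ : ℕ × ℕ → ℕ × ℕ → Set
(p , q) <ₗ (p′ , q′) = p < p′ ⊎ (p ≡ p′ × q < q′)

<ₗ-trans : ∀ {a b c} → a <ₗ b → b <ₗ c → a <ₗ c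
<ₗ-trans (inj₁ p)          (inj₁ q)          = inj₁ (ℕ.<-trans p q)
<ₗ-trans (inj₁ p)          (inj₂ (refl , q)) = inj₁ p
<ₗ-trans (inj₂ (refl , p)) (inj₁ q)          = inj₁ q
<ₗ-trans (inj₂ (refl , p)) (inj₂ (refl , q)) = inj₂ (refl , ℕ.<-trans p q)

<ₗ-irrefl : ∀ {a} → ¬ a <ₗ a
<ₗ-irrefl (inj₁ p)       = ℕ.<-irrefl refl p
<ₗ-irrefl (inj₂ (_ , q)) = ℕ.<-irrefl refl q

<ₗ-suc : ∀ {a p q} → a <ₗ (p , suc q) → a <ₗ (p , q) ⊎ a ≡ (p , q)
<ₗ-suc (inj₁ p) = inj₁ (inj₁ p)
<ₗ-suc (inj₂ (refl , s≤s q≤)) with ℕ.m≤n⇒m<n∨m≡n q≤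
... | inj₁ q<   = inj₁ (inj₂ (refl , q<))
... | inj₂ refl = inj₂ refl

Step⇒<ₗ : ∀ π {d d′} → Step π d d′ → d <ₗ d′
Step⇒<ₗ _ ((q , _) , inj₁ refl)          = inj₂ (refl , q)
Step⇒<ₗ _ (_       , inj₂ ((p , _) , _)) = inj₁ p

-- The pair b is the next one to be examined. Asking for q < n in `complete` lets the end of a row,
-- (p , n), be exchanged for the start of the next, (p + 1 , 0).
record Collected (n : ℕ) (π : ℕ → ℕ) (d : ℕ → ℕ × ℕ) (k : ℕ) (b : ℕ × ℕ) : Set where
  field
    sound    : ∀ {j} → j < k → proj₁ (d j) < n × proj₂ (d j) < n × 0 < crossing π (proj₁ (d j)) (proj₂ (d j))
    complete : ∀ {p q} → q < n → (p , q) <ₗ b → 0 < crossing π p q → ∃[ j ] j < k × d j ≡ (p , q)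
    before   : ∀ {j} → j < k → d j <ₗ b
    sorted   : ∀ {i j} → i < j → j < k → d i <ₗ d j

module _ {n : ℕ} {π : ℕ → ℕ} {d : ℕ → ℕ × ℕ} {k : ℕ} where
  open Collected

  collected-cong : ∀ {d′ b} → (∀ {j} → j < k → d′ j ≡ d j) → Collected n π d k b → Collected n π d′ k b
  collected-cong {d′} {b} eq C = record
    { sound    = λ {j} j<k → subst (λ e → proj₁ e < n × proj₂ e < n × 0 < crossing π (proj₁ e) (proj₂ e))
                                   (sym (eq j<k)) (sound C j<k)
    ; complete = λ q<n lt c → let (j , j<k , dj) = complete C q<n lt c in j , j<k , trans (eq j<k) dj
    ; before   = λ j<k → subst (_<ₗ b) (sym (eq j<k)) (before C j<k)
    ; sorted   = λ i<j j<k → subst₂ _<ₗ_ (sym (eq (ℕ.<-trans i<j j<k))) (sym (eq j<k)) (sorted C i<j j<k)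
    }

  collected-skip : ∀ {p q} → crossing π p q ≡ 0 → Collected n π d k (p , q) → Collected n π d k (p , suc q)
  collected-skip {p} {q} c≡0 C = record
    { sound    = sound C
    ; complete = complete′
    ; before   = λ j<k → <ₗ-trans (before C j<k) (inj₂ (refl , ℕ.n<1+n q))
    ; sorted   = sorted C
    }
    where
    complete′ : ∀ {p′ q′} → q′ < n → (p′ , q′) <ₗ (p , suc q) → 0 < crossing π p′ q′ →
                ∃[ j ] j < k × d j ≡ (p′ , q′)
    complete′ q′<n lt c with <ₗ-suc lt
    ... | inj₁ lt′  = complete C q′<n lt′ c
    ... | inj₂ refl = contradiction c≡0 (ℕ.>⇒≢ c)

  collected-append : ∀ {p q} → p < n → q < n → 0 < crossing π p q → d k ≡ (p , q) →
                     Collected n π d k (p , q) → Collected n π d (suc k) (p , suc q)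
  collected-append {p} {q} p<n q<n c dk C = record
    { sound = sound′ ; complete = complete′ ; before = before′ ; sorted = sorted′ }
    where
    sound′ : ∀ {j} → j < suc k → proj₁ (d j) < n × proj₂ (d j) < n × 0 < crossing π (proj₁ (d j)) (proj₂ (d j))
    sound′ (s≤s j≤k) with ℕ.m≤n⇒m<n∨m≡n j≤k
    ... | inj₁ j<k  = sound C j<k
    ... | inj₂ refl rewrite dk = p<n , q<n , c

    complete′ : ∀ {p′ q′} → q′ < n → (p′ , q′) <ₗ (p , suc q) → 0 < crossing π p′ q′ →
                ∃[ j ] j < suc k × d j ≡ (p′ , q′)
    complete′ q′<n lt c′ with <ₗ-suc lt
    ... | inj₁ lt′  = let (j , j<k , dj) = complete C q′<n lt′ c′ in j , ℕ.m<n⇒m<1+n j<k , dj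
    ... | inj₂ refl = k , ℕ.n<1+n k , dk

    before′ : ∀ {j} → j < suc k → d j <ₗ (p , suc q)
    before′ (s≤s j≤k) with ℕ.m≤n⇒m<n∨m≡n j≤k
    ... | inj₁ j<k  = <ₗ-trans (before C j<k) (inj₂ (refl , ℕ.n<1+n q))
    ... | inj₂ refl rewrite dk = inj₂ (refl , ℕ.n<1+n q)

    sorted′ : ∀ {i j} → i < j → j < suc k → d i <ₗ d j
    sorted′ i<j (s≤s j≤k) with ℕ.m≤n⇒m<n∨m≡n j≤k
    ... | inj₁ j<k  = sorted C i<j j<k
    ... | inj₂ refl = subst (_ <ₗ_) (sym dk) (before C i<j)

  collected-row : ∀ {p} → Collected n π d k (p , n) → Collected n π d k (suc p , 0)
  collected-row {p} C = record
    { sound    = sound C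
    ; complete = λ q<n lt → complete C q<n (row lt q<n)
    ; before   = λ j<k → <ₗ-trans (before C j<k) (inj₁ (ℕ.n<1+n p))
    ; sorted   = sorted C
    }
    where
    row : ∀ {p′ q′} → (p′ , q′) <ₗ (suc p , 0) → q′ < n → (p′ , q′) <ₗ (p , n)
    row (inj₁ (s≤s p′≤p)) q′<n with ℕ.m≤n⇒m<n∨m≡n p′≤p
    ... | inj₁ p′<p = inj₁ p′<p
    ... | inj₂ refl = inj₂ (refl , q′<n)

collected-empty : ∀ {n π d} → Collected n π d 0 (0 , 0)
collected-empty = record
  { sound    = λ ()
  ; complete = λ where _ (inj₁ ()) ; _ (inj₂ ())
  ; before   = λ ()
  ; sorted   = λ _ ()
  }

-- Longest chains by dynamic programming

module _ (R : ℕ → ℕ → Set) where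

  -- The recurrence for the maximum, split in two: `above` alone yields optimality, and `attained`
  -- yields the link followed by the traceback.
  record LongestBefore (f p : ℕ → ℕ) (i : ℕ) : Set where
    field
      attained : f i ≡ 0 ⊎ (∃[ j ] j < i × R j i × p i ≡ j × f i ≡ suc (f j))
      above    : ∀ {j} → j < i → R j i → f j < f i

  Table : (f p : ℕ → ℕ) → ℕ → Set
  Table f p i = ∀ {i′} → i′ < i → LongestBefore f p i′

  -- Nothing is claimed about q when b is 0: the predecessor register is not reset between darts and
  -- may hold a stale index.
  record Best (f : ℕ → ℕ) (i j b q : ℕ) : Set where
    field
      attained : b ≡ 0 ⊎ (∃[ j′ ] j′ < j × R j′ i × q ≡ j′ × b ≡ suc (f j′))
      above    : ∀ {j′} → j′ < j → R j′ i → f j′ < b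

  best-empty : ∀ {f i q} → Best f i 0 0 q
  best-empty = record { attained = inj₁ refl ; above = λ () }

  best-take : ∀ {f i j b q} → b < suc (f j) → R j i → Best f i j b q → Best f i (suc j) (suc (f j)) j
  best-take {f} {i} {j} {b} (s≤s b≤fj) r B = record
    { attained = inj₂ (j , ℕ.n<1+n j , r , refl , refl) ; above = above′ }
    where
    above′ : ∀ {j′} → j′ < suc j → R j′ i → f j′ < suc (f j)
    above′ (s≤s j′≤j) r′ with ℕ.m≤n⇒m<n∨m≡n j′≤j
    ... | inj₁ j′<j = ℕ.m<n⇒m<1+n (ℕ.<-≤-trans (Best.above B j′<j r′) b≤fj)
    ... | inj₂ refl = ℕ.n<1+n (f j)

  best-skip : ∀ {f i j b q} → ¬ (b < suc (f j) × R j i) → Best f i j b q → Best f i (suc j) b q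
  best-skip {f} {i} {j} {b} no-gain B = record
    { attained = Sum.map₂ (λ (j′ , lt , rest) → j′ , ℕ.m<n⇒m<1+n lt , rest) (Best.attained B) ; above = above′ }
    where
    above′ : ∀ {j′} → j′ < suc j → R j′ i → f j′ < b
    above′ (s≤s j′≤j) r′ with ℕ.m≤n⇒m<n∨m≡n j′≤j
    ... | inj₁ j′<j = Best.above B j′<j r′
    ... | inj₂ refl = ℕ.≰⇒> (λ b≤fj → no-gain (s≤s b≤fj , r′))

  table-extend : ∀ {f p i b q} → Table f p i → Best f i i b q → Table (update f i b) (update p i q) (suc i)
  table-extend {f} {p} {i} {b} {q} T B {i′} (s≤s i′≤i) with ℕ.m≤n⇒m<n∨m≡n i′≤i
  ... | inj₁ i′<i = record
    { attained = Sum.map (trans (old i′<i)) (λ (j , j<i′ , r , pj , fj) →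
        j , j<i′ , r , trans (update-≢ p (ℕ.<⇒≢ i′<i)) pj
          , trans (old i′<i) (trans fj (cong suc (sym (old (ℕ.<-trans j<i′ i′<i))))))
        (LongestBefore.attained (T i′<i))
    ; above    = λ j<i′ r → subst₂ _<_ (sym (old (ℕ.<-trans j<i′ i′<i))) (sym (old i′<i))
                                   (LongestBefore.above (T i′<i) j<i′ r)
    }
    where
    old : ∀ {j} → j < i → update f i b j ≡ f j
    old j<i = update-≢ f (ℕ.<⇒≢ j<i)
  ... | inj₂ refl = record
    { attained = Sum.map (trans new) (λ (j , j<i , r , qj , bj) →
        j , j<i , r , trans (update-≡ p {i} refl) qj , trans new (trans bj (cong suc (sym (old j<i)))))
        (Best.attained B)
    ; above    = λ j<i r → subst₂ _<_ (sym (old j<i)) (sym new) (Best.above B j<i r)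
    }
    where
    old : ∀ {j} → j < i → update f i b j ≡ f j
    old j<i = update-≢ f (ℕ.<⇒≢ j<i)

    new : update f i b i ≡ b
    new = update-≡ f {i} refl

  -- Predecessor indices strictly decrease while values drop by one. This bounds the number of
  -- iterations of the traceback.
  table-≤ : ∀ {f p k} → Table f p (suc k) → f k ≤ k
  table-≤ {f} {p} {k} T = bound k ℕ.≤-refl
    where
    bound : ∀ i → i ≤ k → f i ≤ i
    bound = <-rec (λ i → i ≤ k → f i ≤ i) λ i rec i≤k → case i rec i≤k (LongestBefore.attained (T (s≤s i≤k)))
      where
      case : ∀ i → (∀ {j} → j < i → j ≤ k → f j ≤ j) → i ≤ k →
             f i ≡ 0 ⊎ (∃[ j ] j < i × R j i × p i ≡ j × f i ≡ suc (f j)) → f i ≤ i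
      case i rec i≤k (inj₁ eq) rewrite eq = z≤n
      case i rec i≤k (inj₂ (j , j<i , _ , _ , eq)) rewrite eq =
        ℕ.≤-trans (s≤s (rec j<i (ℕ.≤-trans (ℕ.<⇒≤ j<i) i≤k))) j<i

-- Correctness

module Correctness {n} (G : Graph n) (R : PermutationRepresentation G) where
  open Graph G
  open PermutationRepresentation R

  x y : Fin n → ℕ
  x = rank isSTO₁
  y = rank isSTO₂

  private
    module X = Rank isSTO₁
    module Y = Rank isSTO₂

  adjacent-ranks : ∀ u v → u ~ v ⇔ ((x u < x v × y v < y u) ⊎ (x v < x u × y u < y v))
  adjacent-ranks u v = mk⇔
    (λ u~v → Sum.map (λ (p , q) → X.rank-mono p , Y.rank-mono q) (λ (p , q) → X.rank-mono p , Y.rank-mono q)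
               (Equivalence.to (adjacent u v) u~v))
    (λ h → Equivalence.from (adjacent u v)
             (Sum.map (λ (p , q) → X.rank-cancel p , Y.rank-cancel q) (λ (p , q) → X.rank-cancel p , Y.rank-cancel q) h))

  open Edges G
  open Diagram G x y X.rank-injective Y.rank-injective adjacent-ranks

  at : Dart → ℕ × ℕ
  at (c , l) = x c , x l

  -- Stated for separate components rather than a state, so that it outlives register 0, which the
  -- traceback overwrites with the size of the packing.
  record Setup (r : ℕ) (inv π : ℕ → ℕ) : Set where
    field
      r≡n   : r ≡ n
      inv-x : ∀ v → inv (x v) ≡ toℕ v
      π-x   : ∀ v → π (x v) ≡ y v
      π-n   : π n ≡ n

    Precedes⇔≪ : ∀ {u v} → Precedes π (x u) (x v) ⇔ u ≪ v
    Precedes⇔≪ {u} {v} = mk⇔ (λ (p , q) → p , subst₂ _<_ (π-x u) (π-x v) q)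
                             (λ (p , q) → p , subst₂ _<_ (sym (π-x u)) (sym (π-x v)) q)

    private
      to : ∀ {u v} → Precedes π (x u) (x v) → u ≪ v
      to = Equivalence.to Precedes⇔≪

      from : ∀ {u v} → u ≪ v → Precedes π (x u) (x v)
      from = Equivalence.from Precedes⇔≪

    Step⇔⟶ : ∀ {d d′} → Step π (at d) (at d′) ⇔ d ⟶ d′
    Step⇔⟶ = mk⇔
      (λ (l , r) → to l , Sum.map X.rank-injective (λ (a , b , c) → to a , to b , to c) r)
      (λ (l , r) → from l , Sum.map (cong x) (λ (a , b , c) → from a , from b , from c) r)

    Step-sentinel : ∀ d → Step π (at d) (n , n)
    Step-sentinel (c , l) = precedes-n l , inj₂ (precedes-n c , precedes-n c , precedes-n l)
      where
      precedes-n : ∀ v → Precedes π (x v) n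
      precedes-n v = X.rank<n v , subst₂ _<_ (sym (π-x v)) (sym π-n) (Y.rank<n v)

    crossing⇔~ : ∀ {u v} → 0 < crossing π (x u) (x v) ⇔ u ~ v
    crossing⇔~ {u} {v} = mk⇔
      (λ h → Equivalence.from (adjacent-ranks u v)
        (Sum.map (λ (p , q) → p , subst₂ _<_ (π-x v) (π-x u) q) (λ (p , q) → p , subst₂ _<_ (π-x u) (π-x v) q)
          (Equivalence.to (crossing-positive {π} {x u} {x v}) h)))
      (λ u~v → Equivalence.from (crossing-positive {π} {x u} {x v})
        (Sum.map (λ (p , q) → p , subst₂ _<_ (sym (π-x v)) (sym (π-x u)) q)
                 (λ (p , q) → p , subst₂ _<_ (sym (π-x u)) (sym (π-x v)) q)
          (Equivalence.to (adjacent-ranks u v) u~v)))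

  record Inverting (i : ℕ) (σ : State) : Set where
    field
      n≡    : regs σ 0 ≡ n
      i≡    : regs σ 1 ≡ i
      arr₁  : arrs σ 1 ≡ cells x
      arr₂  : arrs σ 2 ≡ cells y
      inv-x : ∀ {v} → toℕ v < i → arrs σ 3 (x v) ≡ toℕ v
      π-x   : ∀ {v} → toℕ v < i → arrs σ 4 (x v) ≡ y v

  -- Ranks are injective, so the write for vertex i hits no cell of an earlier vertex.
  update-at-rank : ∀ {i a b} f (h : Fin n → ℕ) (i<n : i < n) → a ≡ x (fromℕ< i<n) → b ≡ h (fromℕ< i<n) →
                   (∀ {v} → toℕ v < i → f (x v) ≡ h v) →
                   ∀ {v} → toℕ v < suc i → update f a b (x v) ≡ h v
  update-at-rank {i} f h i<n refl refl old {v} (s≤s v≤i) with ℕ.m≤n⇒m<n∨m≡n v≤i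
  ... | inj₁ v<i = trans (update-≢ f (λ xv≡ → ℕ.<⇒≢ v<i
          (trans (cong toℕ (X.rank-injective xv≡)) (Fin.toℕ-fromℕ< i<n)))) (old v<i)
  ... | inj₂ v≡i = trans (update-≡ f (cong x v≡)) (cong h (sym v≡))
    where
    v≡ : v ≡ fromℕ< i<n
    v≡ = Fin.toℕ-injective (trans v≡i (sym (Fin.toℕ-fromℕ< i<n)))

  cells-fromℕ< : ∀ {i} (f : Fin n → ℕ) (i<n : i < n) → cells f i ≡ f (fromℕ< i<n)
  cells-fromℕ< f i<n = subst (λ j → cells f j ≡ f (fromℕ< i<n)) (Fin.toℕ-fromℕ< i<n) (cells-toℕ f (fromℕ< i<n))

  invert-body : ∀ {N i σ} → i < n → Inverting i σ → Run N invertBody σ (Inverting (suc i))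
  invert-body {i = i} {σ} i<n I = put⨾ (put⨾ (run-assign record
    { n≡    = n≡
    ; i≡    = cong suc i≡
    ; arr₁  = arr₁
    ; arr₂  = arr₂
    ; inv-x = update-at-rank (arrs σ 3) toℕ i<n (entry x arr₁) (trans i≡ (sym (Fin.toℕ-fromℕ< i<n))) inv-x
    ; π-x   = update-at-rank (arrs σ 4) y i<n (entry x arr₁) (entry y arr₂) π-x
    }))
    where
    open Inverting I

    entry : ∀ {f} (h : Fin n → ℕ) → f ≡ cells h → f (regs σ 1) ≡ h (fromℕ< i<n)
    entry h f≡ = trans (cong₂ (λ f j → f j) f≡ i≡) (cells-fromℕ< h i<n)

  Ready : State → Set
  Ready σ = Setup (regs σ 0) (arrs σ 3) (arrs σ 4)

  run-invert : ∀ {N} → n ≤ N → Run N invert (input G R) Ready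
  run-invert n≤N = run-seq
    (run-upto Inverting (λ I → cong₂ _∸_ (Inverting.n≡ I) (Inverting.i≡ I)) invert-body n≤N
      (record { n≡ = refl ; i≡ = refl ; arr₁ = refl ; arr₂ = refl ; inv-x = λ () ; π-x = λ () }))
    λ {σ} I → let open Inverting I in run-put record
      { r≡n   = n≡
      ; inv-x = λ v → inv-x (Fin.toℕ<n v)
      ; π-x   = λ v → trans (update-≢ (arrs σ 4) (λ xv≡ → ℕ.<⇒≢ (X.rank<n v) (trans xv≡ n≡))) (π-x (Fin.toℕ<n v))
      ; π-n   = trans (update-≡ (arrs σ 4) (sym n≡)) n≡
      }

  dartAt : State → ℕ → ℕ × ℕ
  dartAt σ j = arrs σ 5 j , arrs σ 6 j

  record Collecting (p q : ℕ) (σ : State) : Set where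
    field
      p≡        : regs σ 1 ≡ p
      ready     : Ready σ
      collected : Collected n (arrs σ 4) (dartAt σ) (regs σ 3) (p , q)

  open Collecting

  row-body : ∀ {N p q σ} → p < n → q < n → Collecting p q σ × regs σ 2 ≡ q →
             Run N rowBody σ (λ τ → Collecting p (suc q) τ × regs τ 2 ≡ suc q)
  row-body {p = p} {σ = σ} p<n q<n (C@record { p≡ = refl } , refl) =
    run-seq {R = λ τ → Collecting p (suc (regs σ 2)) τ × regs τ 2 ≡ regs σ 2}
      (run-ifnz
        (λ crosses → put⨾ (put⨾ (run-assign (record
          { p≡ = refl ; ready = ready C
          ; collected = collected-append p<n q<n crosses
              (cong₂ _,_ (update-≡ (arrs σ 5) {k} refl) (update-≡ (arrs σ 6) {k} refl))
              (collected-cong (λ j<k → cong₂ _,_ (update-≢ (arrs σ 5) (ℕ.<⇒≢ j<k)) (update-≢ (arrs σ 6) (ℕ.<⇒≢ j<k)))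
                              (collected C))
          } , refl))))
        (λ misses → run-skip (record
          { p≡ = refl ; ready = ready C ; collected = collected-skip misses (collected C) } , refl)))
      (λ (C′ , q≡) → run-assign (record
          { p≡ = p≡ C′ ; ready = ready C′ ; collected = collected C′ } , cong suc q≡))
    where
    k = regs σ 3

  collect-body : ∀ {N p σ} → n ≤ N → p < n → Collecting p 0 σ → Run N collectBody σ (Collecting (suc p) 0)
  collect-body {p = p} n≤N p<n C = assign⨾ (run-seq
    (run-upto (λ q σ → Collecting p q σ × regs σ 2 ≡ q) (λ (C , q≡) → cong₂ _∸_ (Setup.r≡n (ready C)) q≡)
      (row-body p<n) n≤N (record { p≡ = p≡ C ; ready = ready C ; collected = collected C } , refl))
    λ (C , _) → run-assign record
      { p≡ = cong suc (p≡ C) ; ready = ready C ; collected = collected-row (collected C) })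

  record Darts (k : ℕ) (d : ℕ → ℕ × ℕ) (π : ℕ → ℕ) : Set where
    field
      dart     : ∀ {j} → j < k → ∃[ e ] IsDart e × d j ≡ at e
      index    : ∀ {e} → IsDart e → ∃[ j ] j < k × d j ≡ at e
      sorted   : ∀ {i j} → i < j → j < k → d i <ₗ d j
      sentinel : d k ≡ (n , n)

    k≤2∣E∣ : k ≤ ∣E∣ G + ∣E∣ G
    k≤2∣E∣ = darts≤2∣E∣ e e-injective (λ i → proj₁ (proj₂ (dart (Fin.toℕ<n i))))
      where
      e : Fin k → Dart
      e i = proj₁ (dart (Fin.toℕ<n i))

      d≡ : ∀ i → d (toℕ i) ≡ at (e i)
      d≡ i = proj₂ (proj₂ (dart (Fin.toℕ<n i)))

      e-injective : Injective _≡_ _≡_ e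
      e-injective {i} {j} ei≡ej with Fin.<-cmp i j | trans (d≡ i) (trans (cong at ei≡ej) (sym (d≡ j)))
      ... | tri< i<j _ _ | eq = contradiction (subst (d (toℕ i) <ₗ_) (sym eq) (sorted i<j (Fin.toℕ<n j))) (<ₗ-irrefl {d (toℕ i)})
      ... | tri≈ _ i≡j _ | _  = i≡j
      ... | tri> _ _ j<i | eq = contradiction (subst (d (toℕ j) <ₗ_) eq (sorted j<i (Fin.toℕ<n i))) (<ₗ-irrefl {d (toℕ j)})

  collected⇒darts : ∀ {k d π r inv} → Setup r inv π → Collected n π d k (n , 0) → d k ≡ (n , n) → Darts k d π
  collected⇒darts {k} {d} {π} S C dk = record { dart = dart ; index = index ; sorted = Collected.sorted C ; sentinel = dk }
    where
    dart : ∀ {j} → j < k → ∃[ e ] IsDart e × d j ≡ at e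
    dart j<k with Collected.sound C j<k
    ... | p<n , q<n , crosses with X.rank-surjective p<n | X.rank-surjective q<n
    ...   | c , xc≡p | l , xl≡q = (c , l)
          , Equivalence.to (Setup.crossing⇔~ S) (subst₂ (λ p q → 0 < crossing π p q) (sym xc≡p) (sym xl≡q) crosses)
          , sym (cong₂ _,_ xc≡p xl≡q)

    index : ∀ {e} → IsDart e → ∃[ j ] j < k × d j ≡ at e
    index {c , l} c~l =
      Collected.complete C (X.rank<n l) (inj₁ (X.rank<n c)) (Equivalence.from (Setup.crossing⇔~ S) c~l)

  Listed : State → Set
  Listed σ = Setup (regs σ 0) (arrs σ 3) (arrs σ 4) × Darts (regs σ 3) (dartAt σ) (arrs σ 4)

  run-collect : ∀ {N σ} → n ≤ N → Ready σ → Run N collect σ Listed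
  run-collect n≤N S = assign⨾ (assign⨾ (run-seq
    (run-upto (λ p → Collecting p 0) (λ C → cong₂ _∸_ (Setup.r≡n (ready C)) (p≡ C)) (collect-body n≤N) n≤N
      (record { p≡ = refl ; ready = S ; collected = collected-empty }))
    λ {τ} C → put⨾ (run-put
      ( ready C
      , collected⇒darts (ready C)
          (collected-cong (λ j<k → cong₂ _,_ (update-≢ (arrs τ 5) (ℕ.<⇒≢ j<k)) (update-≢ (arrs τ 6) (ℕ.<⇒≢ j<k)))
                          (collected C))
          (cong₂ _,_ (trans (update-≡ (arrs τ 5) {regs τ 3} refl) (Setup.r≡n (ready C)))
                     (trans (update-≡ (arrs τ 6) {regs τ 3} refl) (Setup.r≡n (ready C))))))))

  -- Only arrays 4, 5 and 6 are read here, so the relation is unchanged, by computation, under every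
  -- write of `chains` and `trace`.
  Arrow : State → ℕ → ℕ → Set
  Arrow σ i j = 0 < step (arrs σ 4) (dartAt σ i) (dartAt σ j)

  Arrow⇔Step : ∀ σ i j → Arrow σ i j ⇔ Step (arrs σ 4) (dartAt σ i) (dartAt σ j)
  Arrow⇔Step σ i j = step-positive (arrs σ 4) (dartAt σ i) (dartAt σ j)

  Tabulating : ℕ → ℕ → State → Set
  Tabulating k i σ = regs σ 3 ≡ k × regs σ 4 ≡ i × Listed σ × Table (Arrow σ) (arrs σ 7) (arrs σ 8) i

  BestBelow : ℕ → ℕ → State → Set
  BestBelow i j σ = Best (Arrow σ) (arrs σ 7) i j (regs σ 6) (regs σ 7)

  relax-body : ∀ {N k i j σ} → Tabulating k i σ × regs σ 5 ≡ j × BestBelow i j σ →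
               Run N relaxBody σ (λ τ → Tabulating k i τ × regs τ 5 ≡ suc j × BestBelow i (suc j) τ)
  relax-body {k = k} {i} {j} {σ} (T@(_ , refl , _) , refl , B) =
    run-seq {R = λ τ → Tabulating k i τ × regs τ 5 ≡ j × BestBelow i (suc j) τ}
      (run-ifnz
        (λ gain → let (b< , r) = Equivalence.to gain⇔ gain in
          assign⨾ (run-assign (T , refl , best-take (Arrow σ) b< r B)))
        (λ no-gain → run-skip (T , refl ,
          best-skip (Arrow σ) (λ h → ℕ.>⇒≢ (Equivalence.from gain⇔ h) no-gain) B)))
      (λ (T , j≡ , B) → run-assign (T , cong suc j≡ , B))
    where
    gain⇔ : 0 < (suc (arrs σ 7 j) ∸ regs σ 6) ∧ step (arrs σ 4) (dartAt σ j) (dartAt σ i) ⇔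
            (regs σ 6 < suc (arrs σ 7 j) × Arrow σ j i)
    gain⇔ = mk⇔
      (λ h → let (a , r) = Equivalence.to (∧-positive {suc (arrs σ 7 j) ∸ regs σ 6}) h in Equivalence.to ∸-positive a , r)
      (λ (a , r) → Equivalence.from (∧-positive {suc (arrs σ 7 j) ∸ regs σ 6}) (Equivalence.from ∸-positive a , r))

  chain-body : ∀ {N k i σ} → suc k ≤ N → i < suc k → Tabulating k i σ → Run N chainBody σ (Tabulating k (suc i))
  chain-body {k = k} {i} k<N i<1+k T = assign⨾ (assign⨾ (run-seq
    (run-upto (λ j τ → Tabulating k i τ × regs τ 5 ≡ j × BestBelow i j τ)
      (λ ((_ , i≡ , _) , j≡ , _) → cong₂ _∸_ i≡ j≡) (λ _ → relax-body) (ℕ.≤-trans (ℕ.<⇒≤ i<1+k) k<N)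
      (T , refl , best-empty _))
    store))
    where
    store : ∀ {N τ} → Tabulating k i τ × regs τ 5 ≡ i × BestBelow i i τ →
            Run N (put 7 (reg 4) (reg 6) ⨾ put 8 (reg 4) (reg 7) ⨾ assign 4 (con 1 ⊕ reg 4)) τ (Tabulating k (suc i))
    store {τ = τ} ((k≡ , refl , L , T) , _ , B) = put⨾ (put⨾ (run-assign (k≡ , refl , L , table-extend (Arrow τ) T B)))

  run-chains : ∀ {N k σ} → suc k ≤ N → regs σ 3 ≡ k → Listed σ → Run N chains σ (Tabulating k (suc k))
  run-chains {k = k} k<N k≡ L = assign⨾ (run-upto (Tabulating k)
    (λ (k≡ , i≡ , _) → cong₂ (λ k i → suc k ∸ i) k≡ i≡) (chain-body k<N) k<N
    (k≡ , refl , L , λ ()))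

  -- Each dart is sent to the table value at its index. This map is strictly monotone along `⟶`, and
  -- its values stay below that of the sentinel, which every dart precedes.
  optimal : ∀ {σ k D} → regs σ 3 ≡ k → Listed σ → Table (Arrow σ) (arrs σ 7) (arrs σ 8) (suc k) →
            IsEdgeOpenPacking G D → length D ≤ arrs σ 7 k
  optimal {σ} {k} refl (S , Ds) T packing = packing≤ packing f f-mono
    where
    open Darts Ds
    F = arrs σ 7

    bound : ∀ {e} (p : IsDart e) → F (proj₁ (index p)) < F k
    bound {e} p with index p
    ... | j , j<k , dj = LongestBefore.above (T ℕ.≤-refl) j<k
          (Equivalence.from (Arrow⇔Step σ j k) (subst₂ (Step (arrs σ 4)) (sym dj) (sym sentinel) (Setup.Step-sentinel S e)))

    f : ∀ {e} → IsDart e → Fin (F k)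
    f p = fromℕ< (bound p)

    f-mono : ∀ {e e′} (p : IsDart e) (p′ : IsDart e′) → e ⟶ e′ → f p Fin.< f p′
    f-mono p p′ e⟶e′ = subst₂ _<_ (sym (Fin.toℕ-fromℕ< (bound p))) (sym (Fin.toℕ-fromℕ< (bound p′)))
      (mono (index p) (index p′))
      where
      mono : ((j , _) : ∃[ j ] j < k × dartAt σ j ≡ at _) ((j′ , _) : ∃[ j ] j < k × dartAt σ j ≡ at _) → F j < F j′
      mono (j , j<k , dj) (j′ , j′<k , dj′) =
        LongestBefore.above (T (ℕ.m<n⇒m<1+n j′<k)) j<j′ (Equivalence.from (Arrow⇔Step σ j j′) j⟶j′)
        where
        j⟶j′ : Step (arrs σ 4) (dartAt σ j) (dartAt σ j′)
        j⟶j′ = subst₂ (Step (arrs σ 4)) (sym dj) (sym dj′) (Equivalence.from (Setup.Step⇔⟶ S) e⟶e′)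

        -- The listing is sorted by an order extending the step relation, so any other position of j
        -- would put a dart strictly below itself.
        j<j′ : j < j′
        j<j′ with ℕ.<-cmp j j′
        ... | tri< j<j′ _ _ = j<j′
        ... | tri≈ _ refl _ = contradiction (Step⇒<ₗ (arrs σ 4) j⟶j′) (<ₗ-irrefl {dartAt σ j})
        ... | tri> _ _ j′<j = contradiction (<ₗ-trans (Step⇒<ₗ (arrs σ 4) j⟶j′) (sorted j′<j j<k)) (<ₗ-irrefl {dartAt σ j})

  edgeOf-min : ∀ a b → toℕ a ∧ toℕ b ≡ toℕ (proj₁ (edgeOf (a , b)))
  edgeOf-min a b with a Fin.<? b
  ... | yes a<b = trans (∧≡⊓ (toℕ a) (toℕ b)) (ℕ.m≤n⇒m⊓n≡m (ℕ.<⇒≤ a<b))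
  ... | no  a≮b = trans (∧≡⊓ (toℕ a) (toℕ b)) (ℕ.m≥n⇒m⊓n≡n (ℕ.≮⇒≥ a≮b))

  edgeOf-max : ∀ a b → toℕ a + (toℕ b ∸ toℕ a) ≡ toℕ (proj₂ (edgeOf (a , b)))
  edgeOf-max a b with a Fin.<? b
  ... | yes a<b = ℕ.m+[n∸m]≡n (ℕ.<⇒≤ a<b)
  ... | no  a≮b = trans (cong (toℕ a +_) (ℕ.m≤n⇒m∸n≡0 (ℕ.≮⇒≥ a≮b))) (ℕ.+-identityʳ (toℕ a))

  Written : (ℕ → ℕ) → ℕ → (Dart → ℕ) → List Dart → Set
  Written f s h D = ∀ i → f (s + toℕ i) ≡ h (lookup D i)

  written-∷ : ∀ f {s a b} h e {D} → a ≡ s → b ≡ h e → Written f (suc s) h D → Written (update f a b) s h (e ∷ D)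
  written-∷ f {s} h e refl b≡ W Fin.zero    = trans (update-≡ f (ℕ.+-identityʳ s)) b≡
  written-∷ f {s} h e refl b≡ W (Fin.suc i) =
    trans (update-≢ f (ℕ.m+1+n≢m s)) (trans (cong f (ℕ.+-suc s (toℕ i))) (W i))

  -- The list `ds` is the part of the chain already written, in cells r and up. `before` speaks of
  -- whatever steps to the current entry, not of that entry itself, because the first entry is the
  -- sentinel, which is no dart.
  record Tracing (n₀ k opt r : ℕ) (σ : State) : Set where
    field
      opt≡    : regs σ 0 ≡ opt
      r≡      : regs σ 1 ≡ r
      i≤k     : regs σ 4 ≤ k
      value   : arrs σ 7 (regs σ 4) ≡ r
      setup   : Setup n₀ (arrs σ 3) (arrs σ 4)
      darts   : Darts k (dartAt σ) (arrs σ 4)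
      table   : Table (Arrow σ) (arrs σ 7) (arrs σ 8) (suc k)
      ds      : List Dart
      areDart : All IsDart ds
      chain   : AllPairs _⟶_ ds
      before  : ∀ {e} → Step (arrs σ 4) (at e) (dartAt σ (regs σ 4)) → All (e ⟶_) ds
      length≡ : r + length ds ≡ opt
      firsts  : Written (arrs σ 0) r (toℕ ∘ proj₁) (map edgeOf ds)
      seconds : Written (arrs σ 1) r (toℕ ∘ proj₂) (map edgeOf ds)

  trace-body : ∀ {N n₀ k opt r σ} → Tracing n₀ k opt (suc r) σ → Run N traceBody σ (Tracing n₀ k opt r)
  trace-body {N} {n₀} {k} {opt} {r} {σ} record
    { opt≡ = refl ; r≡ = r≡ ; i≤k = i≤k ; value = value ; setup = S ; darts = Ds ; table = T ; ds = ds
    ; areDart = areDart ; chain = chain ; before = before ; length≡ = length≡ ; firsts = fs ; seconds = ss }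
    with LongestBefore.attained (T (s≤s i≤k))
  -- The current value is a successor, so a predecessor was recorded.
  ... | inj₁ f≡0 = contradiction (trans (sym f≡0) value) λ ()
  ... | inj₂ (j , j<i , j⟶i , refl , fi≡)
      with Darts.dart Ds (ℕ.<-≤-trans j<i i≤k)
  ...   | e@(c , l) , c~l , dj = assign⨾ (assign⨾ (put⨾ (run-put record
    { opt≡    = refl
    ; r≡      = r≡′
    ; i≤k     = ℕ.≤-trans (ℕ.<⇒≤ j<i) i≤k
    ; value   = ℕ.suc-injective (trans (sym fi≡) value)
    ; setup   = S
    ; darts   = Ds
    ; table   = T
    ; ds      = e ∷ ds
    ; areDart = c~l ∷ areDart
    ; chain   = e⟶ds ∷ chain
    ; before  = λ {e′} e′→ → let e′⟶e = Equivalence.to (Setup.Step⇔⟶ S {e′} {e}) (subst (Step (arrs σ 4) (at e′)) dj e′→) in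
                  e′⟶e ∷ All.map (⟶-trans e′⟶e) e⟶ds
    ; length≡ = trans (ℕ.+-suc r (length ds)) length≡
    ; firsts  = written-∷ (arrs σ 0) (toℕ ∘ proj₁) (edgeOf e) r≡′
                  (trans (cong₂ _∧_ centre leaf) (edgeOf-min c l)) fs
    ; seconds = written-∷ (arrs σ 1) (toℕ ∘ proj₂) (edgeOf e) r≡′
                  (trans (cong₂ (λ a b → a + (b ∸ a)) centre leaf) (edgeOf-max c l)) ss
    })))
    where
    r≡′ : regs σ 1 ∸ 1 ≡ r
    r≡′ = cong (_∸ 1) r≡

    e⟶ds : All (e ⟶_) ds
    e⟶ds = before (subst (λ d → Step (arrs σ 4) d (dartAt σ (regs σ 4))) dj
             (Equivalence.to (Arrow⇔Step σ j (regs σ 4)) j⟶i))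

    centre : arrs σ 3 (arrs σ 5 j) ≡ toℕ c
    centre = trans (cong (arrs σ 3 ∘ proj₁) dj) (Setup.inv-x S c)

    leaf : arrs σ 3 (arrs σ 6 j) ≡ toℕ l
    leaf = trans (cong (arrs σ 3 ∘ proj₂) dj) (Setup.inv-x S l)

  run-trace : ∀ {N σ k} → suc k ≤ N → Tabulating k (suc k) σ →
              Run N trace σ (Tracing (regs σ 0) k (arrs σ 7 k) 0)
  run-trace {σ = σ} {k} k<N (refl , _ , (S , Ds) , T) = assign⨾ (assign⨾ (assign⨾
    (run-while (Tracing (regs σ 0) k (arrs σ 7 k)) Tracing.r≡ trace-body
      (ℕ.≤-trans (table-≤ (Arrow σ) {p = arrs σ 8} T) (ℕ.<⇒≤ k<N))
      record
        { opt≡ = refl ; r≡ = refl ; i≤k = ℕ.≤-refl ; value = refl ; setup = S ; darts = Ds ; table = T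
        ; ds = [] ; areDart = [] ; chain = [] ; before = λ _ → [] ; length≡ = ℕ.+-identityʳ _
        ; firsts = λ () ; seconds = λ () })))

  Solved : State → Set
  Solved σ = ∃[ D ] Outputs σ D × IsMaximumEdgeOpenPacking G D

  tracing⇒solved : ∀ {n₀ k opt σ} → (∀ {D} → IsEdgeOpenPacking G D → length D ≤ opt) →
                   Tracing n₀ k opt 0 σ → Solved σ
  tracing⇒solved ≤opt T = map edgeOf ds
    , record
      { size   = trans opt≡ (sym length-D)
      ; first  = firsts
      ; second = seconds
      }
    , record
      { isEdgeOpenPacking = chain⇒packing areDart chain
      ; maximum           = λ D′ packing → ℕ.≤-trans (≤opt packing) (ℕ.≤-reflexive (sym length-D))
      }
    where
    open Tracing T
    length-D = trans (length-map edgeOf ds) length≡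

  module _ {N} (n≤N : n ≤ N) (2m<N : suc (∣E∣ G + ∣E∣ G) ≤ N) where

    k<N : ∀ σ → Listed σ → suc (regs σ 3) ≤ N
    k<N _ (_ , Ds) = ℕ.≤-trans (s≤s (Darts.k≤2∣E∣ Ds)) 2m<N

    run-tabulated : ∀ {k σ} → suc k ≤ N → Tabulating k (suc k) σ → Run N trace σ Solved
    run-tabulated {k} {σ} k<N T@(k≡ , _ , L , table) =
      run-map {R = Tracing (regs σ 0) k (arrs σ 7 k) 0}
        (tracing⇒solved (optimal {σ} k≡ L table)) (run-trace k<N T)

    run-listed : ∀ {σ} → Listed σ → Run N (chains ⨾ trace) σ Solved
    run-listed {σ} L = run-seq {R = Tabulating (regs σ 3) (suc (regs σ 3))}
      (run-chains (k<N σ L) refl L) (run-tabulated (k<N σ L))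

    run-solve : Run N solve (input G R) Solved
    run-solve = run-seq {R = Ready} (run-invert n≤N) λ S →
                run-seq {R = Listed} (run-collect n≤N S) run-listed

-- From the common loop bound to n² + m² + 1

double-square : ∀ a → (a + a) ^ 2 ≡ a ^ 2 * 4
double-square = +-*-Solver.solve 1 (λ a → (a :+ a) :^ 2 := a :^ 2 :* con 4) refl
  where open +-*-Solver

-- For positive a one has a + 1 ≤ 2a; the summand 1 takes care of a = 0.
suc-square≤ : ∀ a → suc a ^ 2 ≤ (a ^ 2 + 1) * 4
suc-square≤ zero    = s≤s z≤n
suc-square≤ (suc a) = begin
  suc (suc a) ^ 2           ≤⟨ ℕ.^-monoˡ-≤ 2 (ℕ.+-monoʳ-≤ 1 (ℕ.m≤n+m (suc a) a)) ⟩
  (suc a + suc a) ^ 2       ≡⟨ double-square (suc a) ⟩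
  suc a ^ 2 * 4             ≤⟨ ℕ.*-monoˡ-≤ 4 (ℕ.m≤m+n (suc a ^ 2) 1) ⟩
  (suc a ^ 2 + 1) * 4       ∎
  where open ℕ.≤-Reasoning

-- The constant 16 is 4 · 4: one factor pays for doubling m, the other for the successor.
square≤ : ∀ n m → suc (n ⊔ suc (m + m)) ^ 2 ≤ (n ^ 2 + m ^ 2 + 1) * 16
square≤ n m = Sum.[ (λ eq → subst bounded (sym eq) n-case) , (λ eq → subst bounded (sym eq) m-case) ]′ (ℕ.⊔-sel n (suc (m + m)))
  where
  open ℕ.≤-Reasoning

  bounded : ℕ → Set
  bounded N = suc N ^ 2 ≤ (n ^ 2 + m ^ 2 + 1) * 16

  n-case : bounded n
  n-case = begin
    suc n ^ 2                   ≤⟨ suc-square≤ n ⟩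
    (n ^ 2 + 1) * 4             ≤⟨ ℕ.*-mono-≤ (ℕ.+-monoˡ-≤ 1 (ℕ.m≤m+n (n ^ 2) (m ^ 2))) (ℕ.m≤m+n 4 12) ⟩
    (n ^ 2 + m ^ 2 + 1) * 16    ∎

  m-case : bounded (suc (m + m))
  m-case = begin
    suc (suc (m + m)) ^ 2       ≡⟨ cong (λ a → suc a ^ 2) (sym (ℕ.+-suc m m)) ⟩
    (suc m + suc m) ^ 2         ≡⟨ double-square (suc m) ⟩
    suc m ^ 2 * 4               ≤⟨ ℕ.*-monoˡ-≤ 4 (suc-square≤ m) ⟩
    (m ^ 2 + 1) * 4 * 4         ≡⟨ ℕ.*-assoc (m ^ 2 + 1) 4 4 ⟩
    (m ^ 2 + 1) * 16            ≤⟨ ℕ.*-monoˡ-≤ 16 (ℕ.+-monoˡ-≤ 1 (ℕ.m≤n+m (m ^ 2) (n ^ 2))) ⟩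
    (n ^ 2 + m ^ 2 + 1) * 16    ∎

time-bound : ∀ n m c {s t} → t ≤ s → s ≤ c * suc (n ⊔ suc (m + m)) ^ 2 → t ≤ c * 16 * (n ^ 2 + m ^ 2 + 1)
time-bound n m c {s} {t} t≤s s≤ = begin
  t                                       ≤⟨ t≤s ⟩
  s                                       ≤⟨ s≤ ⟩
  c * suc (n ⊔ suc (m + m)) ^ 2           ≤⟨ ℕ.*-monoʳ-≤ c (square≤ n m) ⟩
  c * ((n ^ 2 + m ^ 2 + 1) * 16)          ≡⟨ x∙yz≈xz∙y c (n ^ 2 + m ^ 2 + 1) 16 ⟩
  c * 16 * (n ^ 2 + m ^ 2 + 1)            ∎
  where open ℕ.≤-Reasoning

-- c is a variable because _*_ would unfold along its large closed value.
solves : ∀ c → (∀ N → steps N solve ≤ c * suc N ^ 2) → SolvesWithin solve (λ n m → c * 16 * (n ^ 2 + m ^ 2 + 1))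
solves c steps≤c {n} G R =
  let run solve⇓ t≤ (D , outputs , maximum) = Correctness.run-solve G R (ℕ.m≤m⊔n n _) (ℕ.m≤n⊔m n _)
  in  _ , _ , D , solve⇓ , time-bound n (∣E∣ G) c t≤ (steps≤c (n ⊔ suc (∣E∣ G + ∣E∣ G))) , outputs , maximum

theorem6 : ∃[ P ] ∃[ c ] SolvesWithin P (λ n m → c * (n ^ 2 + m ^ 2 + 1))
-- Reflexivity checks by computation that the nesting depth of `solve` is the exponent 2.
theorem6 = solve , steps 1 solve * 16 , solves (steps 1 solve) (λ N → steps≤ N solve ℕ.≤-refl)
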